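{- Work in a universe of finite Morley rank; all objects (fields, groups, vector spaces, maps, actions) are definable. Let $\mathbb{K},\mathbb{L},\mathbb{M}$ be fields and $U,V,W$ vector spaces over $\mathbb{K},\mathbb{L},\mathbb{M}$ respectively. Let $T$ be a group acting (not necessarily faithfully) by scalar multiplication on $U,V,W$, via group homomorphisms $\kappa:T\to\mathbb{K}^\times$, $\lambda:T\to\mathbb{L}^\times$, $\mu:T\to\mathbb{M}^\times$, and let $\rho=\kappa\times\lambda\times\mu:T\to\mathbb{K}^\times\times\mathbb{L}^\times\times\mathbb{M}^\times$. Let $\beta:U\times V\to W$ be a non-zero bi-additive map which is plus-or-minus-$T$-covariant: there are $\varepsilon_\mathbb{K},\varepsilon_\mathbb{L},\varepsilon_\mathbb{M}\in\{\pm1\}$ such that $\beta(t^{\varepsilon_\mathbb{K}}\cdot u,t^{\varepsilon_\mathbb{L}}\cdot v)=t^{\varepsilon_\mathbb{M}}\cdot\beta(u,v)$ for all $(t,u,v)\in T\times U\times V$. Then: (1) $\ker\rho=\ker\kappa\cap\ker\lambda=\ker\kappa\cap\ker\mu$; (2) if $\ker\kappa/\ker\rho$ is infinite, then $\mathbb{L}\simeq\mathbb{M}$; (3) if both $\ker\kappa/\ker\rho$ and $\operatorname{im}\kappa$ are infinite, then $\mathbb{K}\simeq\mathbb{L}\simeq\mathbb{M}$; (4) if $\ker\mu/\ker\rho$ is infinite, then $\mathbb{K}\simeq\mathbb{L}$; (5) if both $\ker\mu/\ker\rho$ and $\operatorname{im}\mu$ are infinite, then $\mathbb{K}\simeq\mathbb{L}\simeq\mathbb{M}$.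 (The field isomorphisms are definable.) -}

module Defs where

open import Level using (Level; suc; _⊔_)
open import Algebra.Bundles using (CommutativeRing)
open import Algebra.Core using (Op₁; Op₂)
open import Algebra.Module.Core using (Opₗ)
open import Algebra.Module.Structures using (IsLeftModule)
open import Algebra.Morphism.Structures using (IsRingIsomorphism)
open import Algebra.Structures using (IsCommutativeRing; IsGroup)
open import Data.Fin using (Fin)
open import Data.List.Relation.Unary.Any using (Any)
open import Data.Nat using (ℕ; _≥_; _+_) renaming (suc to 1+_)
open import Data.Product using (∃-syntax; Σ-syntax; _×_; _,_; proj₁; proj₂; uncurry)
open import Data.Sign using (Sign)
open import Data.Unit.Polymorphic using (⊤)
open import Function using (_∘_)
open import Function.Bundles using (_⇔_)
open import Function.Definitions using (Injective)
open import Relation.Binary.Core using (Rel)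
open import Relation.Binary.PropositionalEquality using (_≡_; _≢_)
open import Relation.Nullary using (¬_)
open import Relation.Unary using (Pred; _⊆_; _≐_; _∩_; _∪_; ∁; Satisfiable; Empty)

------------------------------------------------------------------------
-- Finiteness

-- X / ~ is infinite: no finite list of points meets every ~-class of X.
InfiniteModulo : ∀ {a p r} {A : Set a} → Pred A p → Rel A r → Set (a ⊔ p ⊔ r)
InfiniteModulo X _~_ =
  ¬ (∃[ xs ] (∀ x → X x → Any (x ~_) xs))

Infinite : ∀ {a p} {A : Set a} → Pred A p → Set (a ⊔ p)
Infinite X = InfiniteModulo X _≡_

AtLeast : ∀ {a p} {A : Set a} → ℕ → Pred A p → Set (a ⊔ p)
AtLeast {A = A} m X =
  Σ[ f ∈ (Fin m → A) ] (Injective _≡_ _≡_ f × (∀ i → X (f i)))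

------------------------------------------------------------------------
-- Universes of definable sets (Borovik–Poizat, Borovik–Nesin)

data Ty {s} (Sort : Set s) : Set s where
  ι   : Sort → Ty Sort
  _⊗_ : Ty Sort → Ty Sort → Ty Sort

infixr 7 _⊗_

⟦_⟧ᵀ : ∀ {s a} {Sort : Set s} → Ty Sort → (Sort → Set a) → Set a
⟦ ι s   ⟧ᵀ El = El s
⟦ A ⊗ B ⟧ᵀ El = ⟦ A ⟧ᵀ El × ⟦ B ⟧ᵀ El

-- Maps that only select, permute, duplicate or re-bracket coordinates.
data Coord {s} {Sort : Set s} : Ty Sort → Ty Sort → Set s where
  idᶜ   : ∀ {A} → Coord A A
  _∘ᶜ_  : ∀ {A B C} → Coord B C → Coord A B → Coord A C
  π₁    : ∀ {A B} → Coord (A ⊗ B) A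
  π₂    : ∀ {A B} → Coord (A ⊗ B) B
  ⟨_,_⟩ : ∀ {A B C} → Coord A B → Coord A C → Coord A (B ⊗ C)

⟦_⟧ᶜ : ∀ {s a} {Sort : Set s} {A B : Ty Sort} → Coord A B →
       (El : Sort → Set a) → ⟦ A ⟧ᵀ El → ⟦ B ⟧ᵀ El
⟦ idᶜ       ⟧ᶜ El x = x
⟦ g ∘ᶜ f    ⟧ᶜ El x = ⟦ g ⟧ᶜ El (⟦ f ⟧ᶜ El x)
⟦ π₁        ⟧ᶜ El x = proj₁ x
⟦ π₂        ⟧ᶜ El x = proj₂ x
⟦ ⟨ f , g ⟩ ⟧ᶜ El x = ⟦ f ⟧ᶜ El x , ⟦ g ⟧ᶜ El x

record RawUniverse (ℓ : Level) : Set (suc ℓ) where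
  field
    Sort : Set ℓ
    El   : Sort → Set ℓ

  ⟦_⟧ : Ty Sort → Set ℓ
  ⟦ A ⟧ = ⟦ A ⟧ᵀ El

  field
    Definable : (A : Ty Sort) → Pred ⟦ A ⟧ ℓ → Set ℓ

  -- G is the graph of a definable function from the definable set P to the
  -- definable set Q.
  record IsDefinableFunction (A B : Ty Sort)
           (P : Pred ⟦ A ⟧ ℓ) (Q : Pred ⟦ B ⟧ ℓ) (G : Pred ⟦ A ⊗ B ⟧ ℓ)
           : Set ℓ where
    field
      domain-definable   : Definable A P
      codomain-definable : Definable B Q
      graph-definable    : Definable (A ⊗ B) G
      graph-⊆            : ∀ {a b} → G (a , b) → P a × Q b
      total              : ∀ {a} → P a → ∃[ b ] G (a , b)
      functional         : ∀ {a b b′} → G (a , b) → G (a , b′) → b ≡ b′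

  fibre : (A B : Ty Sort) → Pred ⟦ A ⊗ B ⟧ ℓ → ⟦ B ⟧ → Pred ⟦ A ⟧ ℓ
  fibre A B G b a = G (a , b)

  OntoOn : (A B : Ty Sort) → Pred ⟦ B ⟧ ℓ → Pred ⟦ A ⊗ B ⟧ ℓ → Set ℓ
  OntoOn A B Q G = ∀ {b} → Q b → ∃[ a ] G (a , b)

  record IsEquivalenceOn (A : Ty Sort) (P : Pred ⟦ A ⟧ ℓ)
                         (E : Pred ⟦ A ⊗ A ⟧ ℓ) : Set ℓ where
    field
      reflexive  : ∀ {x} → P x → E (x , x)
      symmetric  : ∀ {x y} → P x → P y → E (x , y) → E (y , x)
      transitive : ∀ {x y z} → P x → P y → P z →
                   E (x , y) → E (y , z) → E (x , z)

  DefinableMap : (A B : Ty Sort) → (⟦ A ⟧ → ⟦ B ⟧) → Set ℓ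
  DefinableMap A B f = Definable (A ⊗ B) (λ (a , b) → f a ≡ b)

-- The sets of the universe are the ⟦ A ⟧; those indexed by a sort are
-- arbitrary, and the axiom `quotients` puts every interpretable set
-- (definable subset modulo definable equivalence relation) among them, up to
-- definable bijection.  Hence "a definable field, group, ..." can be taken
-- below to have some ⟦ A ⟧ as its whole carrier.
--
-- Definability is with parameters (axiom `singletons`).  Cartesian products,
-- cylinders and the full sets are obtained from `coordinates`, `equality` and
-- `intersections`.
record Universe (ℓ : Level) : Set (suc ℓ) where
  field
    rawUniverse : RawUniverse ℓ

  open RawUniverse rawUniverse public

  field
    extensional   : ∀ {A P Q} → P ≐ Q → Definable A P → Definable A Q
    intersections : ∀ {A P Q} → Definable A P → Definable A Q → Definable A (P ∩ Q)
    unions        : ∀ {A P Q} → Definable A P → Definable A Q → Definable A (P ∪ Q)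
    complements   : ∀ {A P} → Definable A P → Definable A (∁ P)
    singletons    : ∀ {A} (a : ⟦ A ⟧) → Definable A (_≡ a)
    equality      : ∀ {A} → Definable (A ⊗ A) (λ (x , y) → x ≡ y)
    coordinates   : ∀ {A B P} (f : Coord A B) →
                    Definable B P → Definable A (P ∘ ⟦ f ⟧ᶜ El)
    projections   : ∀ {A B R} → Definable (A ⊗ B) R →
                    Definable A (λ a → ∃[ b ] R (a , b))
    quotients     : ∀ {A P E} → Definable A P → Definable (A ⊗ A) E →
                    IsEquivalenceOn A P E →
                    Σ[ s ∈ Sort ] Σ[ G ∈ Pred ⟦ A ⊗ ι s ⟧ ℓ ]
                      IsDefinableFunction A (ι s) P (λ _ → ⊤) G ×
                      OntoOn A (ι s) (λ _ → ⊤) G ×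
                      (∀ {x y c d} → G (x , c) → G (y , d) →
                        (E (x , y) ⇔ c ≡ d))

-- The Borovik–Poizat rank axioms.  Only the values of `rk` at non-empty
-- definable sets are meaningful.
record FiniteMorleyRank {ℓ} (𝒰 : Universe ℓ) : Set (suc ℓ) where
  open Universe 𝒰
  field
    rk : (A : Ty Sort) → Pred ⟦ A ⟧ ℓ → ℕ

    monotonicity : ∀ {A P} → Definable A P → Satisfiable P → ∀ n →
      rk A P ≥ 1+ n ⇔
      (Σ[ X ∈ (ℕ → Pred ⟦ A ⟧ ℓ) ]
        (∀ i → Definable A (X i) × Satisfiable (X i) × X i ⊆ P × rk A (X i) ≥ n) ×
        (∀ i j → i ≢ j → Empty (X i ∩ X j)))

    definability : ∀ {A B P Q G} → IsDefinableFunction A B P Q G → ∀ n →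
      Definable B (λ b → Satisfiable (fibre A B G b) × rk A (fibre A B G b) ≡ n)

    additivity : ∀ {A B P Q G} → IsDefinableFunction A B P Q G →
      OntoOn A B Q G → Satisfiable P → ∀ n →
      (∀ b → Q b → rk A (fibre A B G b) ≡ n) →
      rk A P ≡ rk B Q + n

    elimination-of-infinite : ∀ {A B P Q G} → IsDefinableFunction A B P Q G →
      ∃[ m ] (∀ b → Q b → AtLeast m (fibre A B G b) → Infinite (fibre A B G b))

------------------------------------------------------------------------
-- Definable algebraic structures

module _ {ℓ} (𝒰 : Universe ℓ) where
  open Universe 𝒰

  record DefinableField : Set ℓ where
    infixl 6 _+ᶠ_
    infixl 7 _*ᶠ_
    field
      ty   : Ty Sort
      _+ᶠ_ : Op₂ ⟦ ty ⟧
      _*ᶠ_ : Op₂ ⟦ ty ⟧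
      -ᶠ_  : Op₁ ⟦ ty ⟧
      0ᶠ   : ⟦ ty ⟧
      1ᶠ   : ⟦ ty ⟧
      isCommutativeRing : IsCommutativeRing _≡_ _+ᶠ_ _*ᶠ_ -ᶠ_ 0ᶠ 1ᶠ
      1≢0               : 1ᶠ ≢ 0ᶠ
      invertible        : ∀ x → x ≢ 0ᶠ → ∃[ y ] x *ᶠ y ≡ 1ᶠ
      +-definable : DefinableMap (ty ⊗ ty) ty (uncurry _+ᶠ_)
      *-definable : DefinableMap (ty ⊗ ty) ty (uncurry _*ᶠ_)

    commutativeRing : CommutativeRing ℓ ℓ
    commutativeRing = record { isCommutativeRing = isCommutativeRing }

    open CommutativeRing commutativeRing public using (ring; rawRing)

  record DefinableGroup : Set ℓ where
    infixl 7 _∙_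
    field
      ty  : Ty Sort
      _∙_ : Op₂ ⟦ ty ⟧
      ε   : ⟦ ty ⟧
      inv : Op₁ ⟦ ty ⟧
      isGroup     : IsGroup _≡_ _∙_ ε inv
      ∙-definable : DefinableMap (ty ⊗ ty) ty (uncurry _∙_)

    infixr 8 _^_
    _^_ : ⟦ ty ⟧ → Sign → ⟦ ty ⟧
    t ^ Sign.+ = t
    t ^ Sign.- = inv t

  record DefinableVectorSpace (K : DefinableField) : Set ℓ where
    private module K = DefinableField K
    infixl 6 _+ᵛ_
    infixr 7 _*ᵛ_
    field
      ty   : Ty Sort
      _+ᵛ_ : Op₂ ⟦ ty ⟧
      0ᵛ   : ⟦ ty ⟧
      -ᵛ_  : Op₁ ⟦ ty ⟧
      _*ᵛ_ : Opₗ ⟦ K.ty ⟧ ⟦ ty ⟧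
      isLeftModule : IsLeftModule K.ring _≡_ _+ᵛ_ 0ᵛ -ᵛ_ _*ᵛ_
      +-definable  : DefinableMap (ty ⊗ ty) ty (uncurry _+ᵛ_)
      *-definable  : DefinableMap (K.ty ⊗ ty) ty (uncurry _*ᵛ_)

  -- A definable group homomorphism T → K^×, as a map to K with non-zero values.
  record Character (T : DefinableGroup) (K : DefinableField) : Set ℓ where
    private
      module T = DefinableGroup T
      module K = DefinableField K
    field
      χ         : ⟦ T.ty ⟧ → ⟦ K.ty ⟧
      nonzero   : ∀ t → χ t ≢ K.0ᶠ
      homo      : ∀ s t → χ (s T.∙ t) ≡ χ s K.*ᶠ χ t
      definable : DefinableMap T.ty K.ty χ

    ker : Pred ⟦ T.ty ⟧ ℓ
    ker t = χ t ≡ K.1ᶠ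

    im : Pred ⟦ K.ty ⟧ ℓ
    im x = ∃[ t ] χ t ≡ x

    -- The action of T by scalar multiplication through χ.
    act : (U : DefinableVectorSpace K) → let open DefinableVectorSpace U in
          ⟦ T.ty ⟧ → ⟦ ty ⟧ → ⟦ ty ⟧
    act U t u = χ t *ᵛ u
      where open DefinableVectorSpace U

  -- H / N is infinite, for subgroups N ≤ H of T.
  InfiniteQuotient : (T : DefinableGroup) → let open DefinableGroup T in
                     (H N : Pred ⟦ ty ⟧ ℓ) → Set ℓ
  InfiniteQuotient T H N = InfiniteModulo H (λ s t → N (inv s ∙ t))
    where open DefinableGroup T

  module _ {T : DefinableGroup} {K L M : DefinableField}
           (κ : Character T K) (λ′ : Character T L) (μ : Character T M) where
    private
      module T = DefinableGroup T
      module K = DefinableField K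
      module L = DefinableField L
      module M = DefinableField M

    ρ : ⟦ T.ty ⟧ → ⟦ K.ty ⊗ L.ty ⊗ M.ty ⟧
    ρ t = Character.χ κ t , Character.χ λ′ t , Character.χ μ t

    kerρ : Pred ⟦ T.ty ⟧ ℓ
    kerρ t = ρ t ≡ (K.1ᶠ , L.1ᶠ , M.1ᶠ)

  record DefinableBiadditive {K L M : DefinableField}
           (U : DefinableVectorSpace K) (V : DefinableVectorSpace L)
           (W : DefinableVectorSpace M) : Set ℓ where
    private
      module U = DefinableVectorSpace U
      module V = DefinableVectorSpace V
      module W = DefinableVectorSpace W
    field
      β         : ⟦ U.ty ⟧ → ⟦ V.ty ⟧ → ⟦ W.ty ⟧
      additiveˡ : ∀ u u′ v → β (u U.+ᵛ u′) v ≡ β u v W.+ᵛ β u′ v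
      additiveʳ : ∀ u v v′ → β u (v V.+ᵛ v′) ≡ β u v W.+ᵛ β u v′
      definable : DefinableMap (U.ty ⊗ V.ty) W.ty (uncurry β)

    Nonzero : Set ℓ
    Nonzero = ∃[ u ] ∃[ v ] β u v ≢ W.0ᵛ

    ±Covariant : {T : DefinableGroup} →
                 Character T K → Character T L → Character T M → Set ℓ
    ±Covariant {T} κ λ′ μ =
      ∃[ εK ] ∃[ εL ] ∃[ εM ] (∀ t u v →
        β (Character.act κ U (t ^ εK) u) (Character.act λ′ V (t ^ εL) v)
          ≡ Character.act μ W (t ^ εM) (β u v))
      where open DefinableGroup T using (_^_)

  infix 4 _≃_
  _≃_ : DefinableField → DefinableField → Set ℓ
  K ≃ L = Σ[ f ∈ (⟦ K.ty ⟧ → ⟦ L.ty ⟧) ]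
            IsRingIsomorphism K.rawRing L.rawRing f × DefinableMap K.ty L.ty f
    where
      module K = DefinableField K
      module L = DefinableField L

{-# OPTIONS --safe #-}
-- The pairs (a , b) of scalars with a·β = b·β form a definable field
-- isomorphism between a subfield of one field and a subfield of the other, and
-- the hypotheses make these subfields infinite.  So everything rests on the
-- fact that an infinite definable subfield k of a field F of finite Morley
-- rank is F itself.
--
-- F has Morley degree one: F has finitely many generic types, so two distinct
-- translations act on them in the same way, hence some d ≠ 0 fixes them all;
-- rescaling by F^× permutes the types, so every translation fixes them all,
-- which forces a single type.
--
-- Now F ≅ k^d additively, d being finite since rk F ≥ d·rk k.  If k ≠ F, then
-- among the monic polynomials of degree d over k (parametrised by k^d) those
-- that split over k and those with a root in F ∖ k form two disjoint sets of
-- full rank: roots of a polynomial are finite in number, and every element of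
-- F is a root of some such polynomial.  This contradicts degree one.
module Submission where

open import Algebra.Bundles using (CommutativeRing; Group)
open import Algebra.Module.Structures using (IsLeftModule)
import Algebra.Properties.Group as GroupProperties
import Algebra.Properties.Ring as RingProperties
import Algebra.Solver.Ring.NaturalCoefficients.Default as RingSolver
open import Algebra.Structures using (IsGroup)
open import Axiom.ExcludedMiddle using (ExcludedMiddle)
open import Data.Empty using (⊥-elim)
open import Data.List using (List; []; _∷_; _++_; map; cartesianProduct)
open import Data.List.Membership.Propositional.Properties using (∈-cartesianProduct⁺; ∈-map⁺)
open import Data.List.Relation.Unary.All as All using (All; []; _∷_; lookupAny)
open import Data.List.Relation.Unary.Any using (Any; here; there)
open import Data.List.Relation.Unary.Any.Properties using (++⁺ˡ; ++⁺ʳ; map⁺; ¬Any[])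
open import Data.Nat using (ℕ; zero; suc; _+_; _∸_; _≤_; _<_; _≥_; z≤n; s≤s)
open import Data.Nat.ListAction using (sum)
open import Data.Nat.Properties
open import Data.Product using (∃-syntax; Σ-syntax; _×_; _,_; proj₁; proj₂; swap; uncurry)
open import Data.Sign using (Sign)
open import Data.Sum using (_⊎_; inj₁; inj₂; [_,_])
open import Data.Unit.Polymorphic using (⊤; tt)
open import Function using (_∘_; id)
open import Function.Bundles using (Equivalence)
open import Level using (0ℓ) renaming (suc to lsuc)
open import Relation.Binary.Core using (Rel)
open import Relation.Binary.Definitions using (tri<; tri≈; tri>)
open import Relation.Binary.PropositionalEquality using (_≡_; _≢_; refl; sym; trans; cong; cong₂; subst; subst₂)
open import Relation.Nullary using (¬_; Dec; yes; no)
open import Relation.Unary using (Pred; _⊆_; _≐_; _∩_; ∁; Satisfiable; Empty)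
open import Defs

-- Finite and infinite sets under excluded middle.

Finite : ∀ {a p} {A : Set a} → Pred A p → Set _
Finite X = ∃[ xs ] (∀ x → X x → Any (x ≡_) xs)

module Classical (em : ∀ {a} → ExcludedMiddle a) where

  abstract
    dne : ∀ {a} {P : Set a} → ¬ ¬ P → P
    dne {P = P} nn with em {P = P}
    ... | yes p = p
    ... | no np = ⊥-elim (nn np)

    uncovered : ∀ {a p r} {A : Set a} {X : Pred A p} {R : Rel A r} →
      InfiniteModulo X R → ∀ xs → ∃[ x ] (X x × ¬ Any (R x) xs)
    uncovered inf xs =
      dne λ none → inf (xs , λ x Xx → dne λ nc → none (x , Xx , nc))

    module _ {a p r} {A : Set a} {X : Pred A p} {R : Rel A r} (inf : InfiniteModulo X R) where
      private
        next : List A → A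
        next xs = proj₁ (uncovered inf xs)

        prefix : ℕ → List A
        prefix zero    = []
        prefix (suc n) = next (prefix n) ∷ prefix n

      enum : ℕ → A
      enum n = next (prefix n)

      enum-∈ : ∀ n → X (enum n)
      enum-∈ n = proj₁ (proj₂ (uncovered inf (prefix n)))

      private
        earlier : ∀ {i j} → i < j → R (enum j) (enum i) → ∀ n → i < n → Any (R (enum j)) (prefix n)
        earlier i<j r (suc n) i<n with m≤n⇒m<n∨m≡n i<n
        ... | inj₁ (s≤s i<n′) = there (earlier i<j r n i<n′)
        ... | inj₂ refl       = here r

      -- Each point of `enum` is chosen off the list of its predecessors. As `R` is an arbitrary
      -- relation, the order of its arguments matters: the later point stands on the left.
      enum-new : ∀ {i j} → i < j → ¬ R (enum j) (enum i)
      enum-new {i} {j} i<j r =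
        proj₂ (proj₂ (uncovered inf (prefix j))) (earlier i<j r j i<j)

    enum-injective : ∀ {a p} {A : Set a} {X : Pred A p} (inf : Infinite X) →
      ∀ {i j} → i ≢ j → enum inf i ≢ enum inf j
    enum-injective inf {i} {j} i≢j eq with <-cmp i j
    ... | tri< i<j _ _ = enum-new inf i<j (sym eq)
    ... | tri≈ _ i≡j _ = i≢j i≡j
    ... | tri> _ _ j<i = enum-new inf j<i eq

  ℕ-infinite : ∀ {p} {X : Pred ℕ p} → (∀ n → X n) → Infinite X
  -- `suc (sum xs)` exceeds every member of `xs`.
  ℕ-infinite all (xs , cov) = 1+n≰n (bounded (suc (sum xs)) xs (cov _ (all _)))
    where
    bounded : ∀ n xs → Any (n ≡_) xs → n ≤ sum xs
    bounded n (x ∷ xs) (here refl) = m≤m+n x (sum xs)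
    bounded n (x ∷ xs) (there p)   = ≤-trans (bounded n xs p) (m≤n+m (sum xs) x)

  -- Induction on `ys`: if only finitely many points of `X` are related to the head, removing them
  -- leaves an infinite set that the tail still covers.
  pigeonhole : ∀ {a b p r} {A : Set a} {B : Set b} {X : Pred A p} {R : A → B → Set r} →
    Infinite X → ∀ ys → (∀ x → X x → Any (R x) ys) → ∃[ y ] Infinite (λ x → X x × R x y)
  pigeonhole inf [] cov = ⊥-elim (inf ([] , λ x Xx → ⊥-elim (¬Any[] (cov x Xx))))
  pigeonhole {X = X} {R} inf (y ∷ ys) cov with em {P = Finite (λ x → X x × R x y)}
  ... | no ¬fin = y , ¬fin
  ... | yes (xs , fin) with pigeonhole {X = λ x → X x × ¬ R x y} {R = R} inf′ ys cov′
    where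
    inf′ : Infinite (λ x → X x × ¬ R x y)
    inf′ (zs , fin′) = inf (xs ++ zs , covers)
      where
      covers : ∀ x → X x → Any (x ≡_) (xs ++ zs)
      covers x Xx with em {P = R x y}
      ... | yes r = ++⁺ˡ (fin x (Xx , r))
      ... | no ¬r = ++⁺ʳ xs (fin′ x (Xx , ¬r))
    cov′ : ∀ x → X x × ¬ R x y → Any (R x) ys
    cov′ x (Xx , ¬r) with cov x Xx
    ... | here r  = ⊥-elim (¬r r)
    ... | there q = q
  ... | z , infz = z , λ (ws , c) → infz (ws , λ x ((Xx , _) , r) → c x (Xx , r))

  -- If finitely many values sufficed, two points in the enumeration of `X` would share one, and
  -- `reflects` would relate the later point to the earlier.
  infinite-image : ∀ {a b p q r} {A : Set a} {B : Set b} {X : Pred A p} {Y : Pred B q} {R : Rel A r} →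
    InfiniteModulo X R → (f : A → B) → (∀ {x} → X x → Y (f x)) →
    (∀ {x y} → X x → X y → f x ≡ f y → R x y) → Infinite Y
  infinite-image inf f maps reflects (ys , cov) =
    distinct (enum-injective fibre {0} {1} λ ())
      (trans (proj₂ (enum-∈ fibre 0)) (sym (proj₂ (enum-∈ fibre 1))))
    where
    s = enum inf
    fibre = proj₂ (pigeonhole {X = λ (n : ℕ) → ⊤ {0ℓ}} {R = λ n y → f (s n) ≡ y}
                     (ℕ-infinite λ _ → tt) ys (λ n _ → cov _ (maps (enum-∈ inf n))))
    distinct : ∀ {i j} → i ≢ j → f (s i) ≢ f (s j)
    distinct {i} {j} i≢j eq with <-cmp i j
    ... | tri< i<j _ _ = enum-new inf i<j (reflects (enum-∈ inf j) (enum-∈ inf i) (sym eq))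
    ... | tri≈ _ i≡j _ = i≢j i≡j
    ... | tri> _ _ j<i = enum-new inf j<i (reflects (enum-∈ inf i) (enum-∈ inf j) eq)

  -- Definable maps and closure properties of definable sets.

  module Definability {ℓ} (𝒰 : Universe ℓ) where
    open Universe 𝒰

    infix  4 _⇒_
    -- Functions are bundled with the definability of their graphs, so that a set described by
    -- composing such maps is definable by `preimage` or `equal`.
    record _⇒_ (A B : Ty Sort) : Set ℓ where
      constructor mk
      field
        fun : ⟦ A ⟧ → ⟦ B ⟧
        graph : DefinableMap A B fun
    open _⇒_ public

    coord : ∀ {A B} → Coord A B → A ⇒ B
    coord c = mk (⟦ c ⟧ᶜ El) (coordinates ⟨ c ∘ᶜ π₁ , π₂ ⟩ equality)

    preimage : ∀ {A B P} (f : A ⇒ B) → Definable B P → Definable A (P ∘ fun f)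
    preimage {P = P} f P-def =
      extensional ((λ { (b , refl , p) → p }) , λ p → _ , refl , p)
        (projections (intersections (graph f) (coordinates π₂ P-def)))

    ⟪_,_⟫ : ∀ {A B C} → A ⇒ B → A ⇒ C → A ⇒ B ⊗ C
    ⟪ f , g ⟫ = mk (λ a → fun f a , fun g a)
      (extensional ((λ { (refl , refl) → refl }) , λ { refl → refl , refl })
        (intersections (coordinates ⟨ π₁ , π₁ ∘ᶜ π₂ ⟩ (graph f))
                       (coordinates ⟨ π₁ , π₂ ∘ᶜ π₂ ⟩ (graph g))))

    infixr 9 _∘ₘ_
    _∘ₘ_ : ∀ {A B C} → B ⇒ C → A ⇒ B → A ⇒ C
    g ∘ₘ f = mk (fun g ∘ fun f) (preimage ⟪ f∘π₁ , coord π₂ ⟫ (graph g))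
      where
      f∘π₁ = mk (fun f ∘ proj₁) (coordinates ⟨ π₁ ∘ᶜ π₁ , π₂ ⟩ (graph f))

    const : ∀ {A B} → ⟦ B ⟧ → A ⇒ B
    const b = mk (λ _ → b) (extensional (sym , sym) (coordinates π₂ (singletons b)))

    equal : ∀ {A B} (f g : A ⇒ B) → Definable A (λ a → fun f a ≡ fun g a)
    equal f g = preimage ⟪ f , g ⟫ equality

    full : ∀ {A} → Definable A (λ _ → ⊤)
    full = extensional ((λ _ → tt) , λ _ → refl) (equal (coord idᶜ) (coord idᶜ))

    universal : ∀ {A B R} → Definable (A ⊗ B) R → Definable A (λ a → ∀ b → R (a , b))
    universal R-def = extensional
      ((λ ¬∃¬ b → dne λ ¬r → ¬∃¬ (b , ¬r)) , λ all (b , ¬r) → ¬r (all b))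
      (complements (projections (complements R-def)))

    image-definable : ∀ {A B P} (f : A ⇒ B) → Definable A P →
      Definable B (λ b → ∃[ a ] (P a × fun f a ≡ b))
    image-definable f P-def = projections
      (intersections (coordinates π₂ P-def) (coordinates ⟨ π₂ , π₁ ⟩ (graph f)))

    infixr 8 _^⁺_
    -- Tuples of length n + 1: the universe has no one-element type.
    _^⁺_ : Ty Sort → ℕ → Ty Sort
    A ^⁺ zero  = A
    A ^⁺ suc n = A ⊗ A ^⁺ n

    AllOf : ∀ {A} → Pred ⟦ A ⟧ ℓ → ∀ n → Pred ⟦ A ^⁺ n ⟧ ℓ
    AllOf P zero    a        = P a
    AllOf P (suc n) (a , as) = P a × AllOf P n as

    AllOf-definable : ∀ {A P} → Definable A P → ∀ n → Definable (A ^⁺ n) (AllOf P n)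
    AllOf-definable P-def zero    = P-def
    AllOf-definable P-def (suc n) =
      intersections (coordinates π₁ P-def) (coordinates π₂ (AllOf-definable P-def n))

-- Rank calculus from the Borovik-Poizat axioms.

module Rank (em : ∀ {a} → ExcludedMiddle a) {ℓ} (𝒰 : Universe ℓ) (fmr : FiniteMorleyRank 𝒰) where
  open Classical em
  open Definability 𝒰
  open Universe 𝒰
  open FiniteMorleyRank fmr

  -- Lower bounds are what the monotonicity axiom characterises. Definability and non-emptiness are
  -- carried along because the rank means nothing without them.
  Ge : (A : Ty Sort) → ℕ → Pred ⟦ A ⟧ ℓ → Set ℓ
  Ge A n P = Definable A P × Satisfiable P × rk A P ≥ n

  Ge-from-sequence : ∀ {A n P} → Definable A P → (X : ℕ → Pred ⟦ A ⟧ ℓ) →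
    (∀ i → Ge A n (X i)) → (∀ i → X i ⊆ P) →
    (∀ {i j} → i < j → Empty (X i ∩ X j)) → Ge A (suc n) P
  Ge-from-sequence {A} {n} {P} P-def X ge X⊆P disjoint =
    P-def , sat , Equivalence.from (monotonicity P-def sat n)
      (X , (λ i → let d , s , r = ge i in d , s , X⊆P i , r) , disjoint′)
    where
    sat : Satisfiable P
    sat = let _ , (x , Xx) , _ = ge 0 in x , X⊆P 0 Xx
    disjoint′ : ∀ i j → i ≢ j → Empty (X i ∩ X j)
    disjoint′ i j i≢j x (p , q) with <-cmp i j
    ... | tri< i<j _ _ = disjoint i<j x (p , q)
    ... | tri≈ _ i≡j _ = i≢j i≡j
    ... | tri> _ _ j<i = disjoint j<i x (q , p)

  Ge-to-sequence : ∀ {A n P} → Ge A (suc n) P → Σ[ X ∈ (ℕ → Pred ⟦ A ⟧ ℓ) ]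
    (∀ i → Ge A n (X i)) × (∀ i → X i ⊆ P) × (∀ {i j} → i ≢ j → Empty (X i ∩ X j))
  Ge-to-sequence {n = n} (P-def , sat , r) with Equivalence.to (monotonicity P-def sat n) r
  ... | X , props , disjoint =
    X , (λ i → let d , s , _ , r = props i in d , s , r)
      , (λ i → let _ , _ , X⊆P , _ = props i in X⊆P)
      , disjoint _ _

  Ge-mono : ∀ {A n P Q} → P ⊆ Q → Definable A Q → Ge A n P → Ge A n Q
  Ge-mono {n = zero}  P⊆Q Q-def (_ , (x , Px) , _) = Q-def , (x , P⊆Q Px) , z≤n
  Ge-mono {n = suc n} P⊆Q Q-def ge =
    let X , X-ge , X⊆P , disjoint = Ge-to-sequence ge
    in Ge-from-sequence Q-def X X-ge (λ i → P⊆Q ∘ X⊆P i) (disjoint ∘ <⇒≢)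

  rk-mono : ∀ {A P Q} → Definable A P → Definable A Q → Satisfiable P → P ⊆ Q → rk A P ≤ rk A Q
  rk-mono P-def Q-def sat P⊆Q = proj₂ (proj₂ (Ge-mono P⊆Q Q-def (P-def , sat , ≤-refl)))

  rk-cong : ∀ {A P Q} → Definable A P → Definable A Q → Satisfiable P → P ≐ Q → rk A P ≡ rk A Q
  rk-cong P-def Q-def (x , Px) (P⊆Q , Q⊆P) =
    ≤-antisym (rk-mono P-def Q-def (x , Px) P⊆Q) (rk-mono Q-def P-def (x , P⊆Q Px) Q⊆P)

  -- Induction on `n`. Of the infinitely many disjoint pieces of `R`, each keeps its rank inside `P`
  -- or inside `∁ P`, and one of these two cases occurs infinitely often.
  Ge-split : ∀ {A} n {P R} → Definable A P → Ge A n R → Ge A n (R ∩ P) ⊎ Ge A n (R ∩ ∁ P)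
  Ge-split zero {P} P-def (R-def , (x , Rx) , _) with em {P = P x}
  ... | yes Px = inj₁ (intersections R-def P-def , (x , Rx , Px) , z≤n)
  ... | no ¬Px = inj₂ (intersections R-def (complements P-def) , (x , Rx , ¬Px) , z≤n)
  Ge-split {A} (suc n) {P} {R} P-def ge@(R-def , _) = result
    where
    seq = Ge-to-sequence ge
    X = proj₁ seq
    X⊆R = proj₁ (proj₂ (proj₂ seq))
    disjoint = proj₂ (proj₂ (proj₂ seq))

    fromInfinite : ∀ {Q} → Definable A Q → Infinite (λ i → Ge A n (X i ∩ Q)) → Ge A (suc n) (R ∩ Q)
    fromInfinite Q-def inf = Ge-from-sequence (intersections R-def Q-def)
      (λ i → X (enum inf i) ∩ _) (enum-∈ inf) (λ i (Xx , Qx) → X⊆R _ Xx , Qx)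
      (λ i<j x ((p , _) , (q , _)) → disjoint (enum-injective inf (<⇒≢ i<j)) x (p , q))

    result : Ge A (suc n) (R ∩ P) ⊎ Ge A (suc n) (R ∩ ∁ P)
    result with em {P = Finite (λ i → Ge A n (X i ∩ P))}
    ... | no inf = inj₁ (fromInfinite P-def inf)
    ... | yes (xs , cov) = inj₂ (fromInfinite (complements P-def) inf)
      where
      inf : Infinite (λ i → Ge A n (X i ∩ ∁ P))
      inf (ys , cov′) = ℕ-infinite {X = λ _ → ⊤ {ℓ}} (λ _ → tt) (xs ++ ys , λ i _ →
        [ (λ g → ++⁺ˡ (cov i g)) , (λ g → ++⁺ʳ xs (cov′ i g)) ] (Ge-split n P-def (proj₁ (proj₂ seq) i)))

  -- Split along `R N`: either that piece keeps the rank, or the remainder does and is covered by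
  -- the pieces of smaller index.
  Ge-⋃ : ∀ {A n P} N (R : ℕ → Pred ⟦ A ⟧ ℓ) → (∀ i → Definable A (R i)) → Ge A n P →
    (∀ {a} → P a → ∃[ i ] (i < N × R i a)) → ∃[ i ] Ge A n (P ∩ R i)
  Ge-⋃ zero R R-def (_ , (x , Px) , _) cov with cov Px
  ... | _ , () , _
  Ge-⋃ {n = n} {P} (suc N) R R-def ge cov with Ge-split n (R-def N) ge
  ... | inj₁ g = N , g
  ... | inj₂ g with Ge-⋃ N R R-def g cov′
    where
    cov′ : ∀ {a} → P a × ¬ R N a → ∃[ i ] (i < N × R i a)
    cov′ (Pa , ¬RN) with cov Pa
    ... | i , s≤s i≤N , Ri with m≤n⇒m<n∨m≡n i≤N
    ...   | inj₁ i<N  = i , i<N , Ri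
    ...   | inj₂ refl = ⊥-elim (¬RN Ri)
  ... | i , g′ = i , Ge-mono (λ ((p , _) , r) → p , r) (intersections (proj₁ ge) (R-def i)) g′

  -- Positive rank supplies infinitely many disjoint non-empty subsets, and a point chosen in each
  -- makes `P` infinite.
  finite⇒rk≡0 : ∀ {A P} → Definable A P → Satisfiable P → Finite P → rk A P ≡ 0
  finite⇒rk≡0 {A} {P} P-def sat fin = n<1⇒n≡0 (≰⇒> λ r → contra (P-def , sat , r))
    where
    contra : ¬ Ge A 1 P
    contra ge =
      infinite-image {X = λ _ → ⊤ {0ℓ}} {Y = P} (ℕ-infinite λ _ → tt) pt (λ {i} _ → X⊆P i (pt-∈ i))
        (λ {i} {j} _ _ eq → dne λ i≢j → disjoint i≢j _ (pt-∈ i , subst (X j) (sym eq) (pt-∈ j))) fin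
      where
      seq = Ge-to-sequence ge
      X = proj₁ seq
      X⊆P = proj₁ (proj₂ (proj₂ seq))
      disjoint = proj₂ (proj₂ (proj₂ seq))
      pt : ℕ → ⟦ A ⟧
      pt i = proj₁ (proj₁ (proj₂ (proj₁ (proj₂ seq) i)))
      pt-∈ : ∀ i → X i (pt i)
      pt-∈ i = proj₂ (proj₁ (proj₂ (proj₁ (proj₂ seq) i)))

  infinite⇒Ge : ∀ {A P} → Definable A P → Infinite P → Ge A 1 P
  infinite⇒Ge P-def inf = Ge-from-sequence P-def (λ i → _≡ enum inf i)
    (λ i → singletons _ , (_ , refl) , z≤n) (λ { i refl → enum-∈ inf i })
    (λ { i<j x (refl , eq) → enum-injective inf (<⇒≢ i<j) eq })

  module _ {A B : Ty Sort} {P : Pred ⟦ A ⟧ ℓ} (f : A ⇒ B) (P-def : Definable A P) where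

    Fibre : ⟦ B ⟧ → Pred ⟦ A ⟧ ℓ
    Fibre b a = P a × fun f a ≡ b

    Fibre-definable : ∀ b → Definable A (Fibre b)
    Fibre-definable b = intersections P-def (preimage f (singletons b))

    private
      isFunction : ∀ {Q} → Definable B Q → (∀ {a} → P a → Q (fun f a)) →
        IsDefinableFunction A B P Q (λ (a , b) → P a × fun f a ≡ b)
      isFunction Q-def maps = record
        { domain-definable   = P-def
        ; codomain-definable = Q-def
        ; graph-definable    = intersections (coordinates π₁ P-def) (graph f)
        ; graph-⊆            = λ { (p , refl) → p , maps p }
        ; total              = λ p → _ , p , refl
        ; functional         = λ (_ , eq) (_ , eq′) → trans (sym eq) eq′
        }

    rk-additive : ∀ {Q} → Definable B Q → Satisfiable P → (∀ {a} → P a → Q (fun f a)) →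
      (∀ {b} → Q b → Satisfiable (Fibre b)) → ∀ n → (∀ {b} → Q b → rk A (Fibre b) ≡ n) →
      rk A P ≡ rk B Q + n
    rk-additive Q-def sat maps onto n fibres =
      additivity (isFunction Q-def maps) onto sat n (λ b → fibres)

    rk-finite-fibres : ∀ {Q} → Definable B Q → Satisfiable P → (∀ {a} → P a → Q (fun f a)) →
      (∀ {b} → Q b → Satisfiable (Fibre b)) → (∀ b → Finite (Fibre b)) → rk A P ≡ rk B Q
    rk-finite-fibres Q-def sat maps onto finite = trans
      (rk-additive Q-def sat maps onto 0 λ q → finite⇒rk≡0 (Fibre-definable _) (onto q) (finite _))
      (+-identityʳ _)

    rk-injective : ∀ {Q} → Definable B Q → Satisfiable P → (∀ {a} → P a → Q (fun f a)) →
      (∀ {b} → Q b → Satisfiable (Fibre b)) →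
      (∀ {a a′} → P a → P a′ → fun f a ≡ fun f a′ → a ≡ a′) → rk A P ≡ rk B Q
    rk-injective Q-def sat maps onto inj = rk-finite-fibres Q-def sat maps onto finite
      where
      finite : ∀ b → Finite (Fibre b)
      finite b with em {P = Satisfiable (Fibre b)}
      ... | yes (a , p , eq) = a ∷ [] , λ a′ (p′ , eq′) → here (inj p′ p (trans eq′ (sym eq)))
      ... | no empty         = [] , λ a p → ⊥-elim (empty (a , p))

    FibreRank : ℕ → Pred ⟦ B ⟧ ℓ
    FibreRank n b = Satisfiable (Fibre b) × rk A (Fibre b) ≡ n

    FibreRank-definable : ∀ n → Definable B (FibreRank n)
    FibreRank-definable n = definability (isFunction full _) n

    -- Additivity speaks only of fibres of constant rank, so `P` is cut according to the rank of the
    -- fibre through each point. By `FibreRank-bounded` only finitely many strata are non-empty.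
    Stratum : ℕ → Pred ⟦ A ⟧ ℓ
    Stratum n = P ∩ (FibreRank n ∘ fun f)

    Stratum-definable : ∀ n → Definable A (Stratum n)
    Stratum-definable n = intersections P-def (preimage f (FibreRank-definable n))

    FibreRank-bounded : ∀ {b n} → FibreRank n b → n ≤ rk A P
    FibreRank-bounded (sat , refl) = rk-mono (Fibre-definable _) P-def sat proj₁

  module _ {A B : Ty Sort} {P : Pred ⟦ A ⟧ ℓ} (f : A ⇒ B) (P-def : Definable A P) where

    rk-Stratum : ∀ n → Satisfiable (Stratum f P-def n) →
      rk A (Stratum f P-def n) ≡ rk B (FibreRank f P-def n) + n
    rk-Stratum n sat = rk-additive f (Stratum-definable f P-def n) (FibreRank-definable f P-def n)
      sat proj₂ onto n fibres
      where
      onto : ∀ {b} → FibreRank f P-def n b → Satisfiable (Fibre f (Stratum-definable f P-def n) b)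
      onto r@((a , p , refl) , _) = a , (p , r) , refl
      fibres : ∀ {b} → FibreRank f P-def n b → rk A (Fibre f (Stratum-definable f P-def n) b) ≡ n
      fibres {b} r@(_ , eq) = trans
        (rk-cong (Fibre-definable f (Stratum-definable f P-def n) b) (Fibre-definable f P-def b) (onto r)
          ((λ ((p , _) , e) → p , e) , λ { (p , refl) → (p , r) , refl }))
        eq

    -- Some stratum keeps the rank of `P`. If its fibres have rank `n`, additivity gives
    -- `N + m ≤ N + n`, since its base has rank at most `N`.
    Ge-fibre : ∀ {m N} → Ge A (N + m) P → (∀ {Q} → Definable B Q → Satisfiable Q → rk B Q ≤ N) →
      ∃[ b ] Ge A m (Fibre f P-def b)
    Ge-fibre {m} {N} ge bound
      with Ge-⋃ (suc (rk A P)) (λ n → FibreRank f P-def n ∘ fun f)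
             (λ n → preimage f (FibreRank-definable f P-def n)) ge
             (λ p → _ , s≤s (FibreRank-bounded f P-def ((_ , p , refl) , refl)) , (_ , p , refl) , refl)
    ... | n , _ , sat@(a , p , fa) , r =
      fun f a , Fibre-definable f P-def _ , proj₁ fa , subst (m ≤_) (sym (proj₂ fa)) m≤n
      where
      m≤n : m ≤ n
      m≤n = +-cancelˡ-≤ N m n (≤-trans r (≤-trans (≤-reflexive (rk-Stratum n sat))
        (+-monoˡ-≤ n (bound (FibreRank-definable f P-def n) (fun f a , fa)))))

    -- Sort the points of `Q` by the rank of their fibres. One of the finitely many classes keeps
    -- the rank of `Q`, and by additivity the stratum above it has at least the rank of its base.
    Ge-onto : ∀ {m Q} → Ge B m Q → (∀ {b} → Q b → Satisfiable (Fibre f P-def b)) → Ge A m P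
    Ge-onto {m} {Q} ge onto
      with Ge-⋃ (suc (rk A P)) (FibreRank f P-def) (FibreRank-definable f P-def) ge
             (λ q → _ , s≤s (FibreRank-bounded f P-def (onto q , refl)) , onto q , refl)
    ... | n , _ , (b , q , r@((a , p , refl) , _)) , le =
      P-def , (a , p) , ≤-trans le (≤-trans
        (rk-mono (intersections (proj₁ ge) (FibreRank-definable f P-def n)) (FibreRank-definable f P-def n) (b , q , r) proj₂)
        (≤-trans (m≤m+n _ n) (≤-trans (≤-reflexive (sym (rk-Stratum n (a , p , r))))
          (rk-mono (Stratum-definable f P-def n) P-def (a , p , r) proj₁))))

  Ge-injective : ∀ {A B n P Q} (f : A ⇒ B) → Definable B Q → Ge A n P → (∀ {a} → P a → Q (fun f a)) →
    (∀ {a a′} → P a → P a′ → fun f a ≡ fun f a′ → a ≡ a′) → Ge B n Q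
  Ge-injective f Q-def (P-def , sat@(a , p) , r) maps inj =
    Ge-mono (λ { (a , p , refl) → maps p }) Q-def
      ( image-definable f P-def , (fun f a , a , p , refl)
      , ≤-trans r (≤-reflexive (rk-injective f P-def (image-definable f P-def) sat
          (λ p → _ , p , refl) id inj)))

-- Elementary arithmetic in a definable field.

module FieldProperties (em : ∀ {a} → ExcludedMiddle a) {ℓ} (𝒰 : Universe ℓ) (F : DefinableField 𝒰) where
  open Classical em
  open Definability 𝒰
  open Universe 𝒰
  open DefinableField F public
    using (ty; 1≢0; invertible; +-definable; *-definable)
  open CommutativeRing (DefinableField.commutativeRing F) public
    using (0#; 1#; commutativeSemiring; ring)
    renaming (_+_ to _⊕_; _*_ to _⊛_; -_ to ⊖_;
              +-comm to ⊕-comm; +-assoc to ⊕-assoc; +-identityˡ to ⊕-identityˡ; +-identityʳ to ⊕-identityʳ;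
              -‿inverseˡ to ⊖-inverseˡ; -‿inverseʳ to ⊖-inverseʳ;
              *-comm to ⊛-comm; *-assoc to ⊛-assoc; *-identityˡ to ⊛-identityˡ; *-identityʳ to ⊛-identityʳ;
              zeroˡ to ⊛-zeroˡ; zeroʳ to ⊛-zeroʳ; distribˡ to ⊛-distribˡ)
  open RingProperties ring public using ()
    renaming (-‿involutive to ⊖-involutive; +-cancelʳ to ⊕-cancelʳ; +-cancelˡ to ⊕-cancelˡ)
  module Solver = RingSolver commutativeSemiring

  infixl 6 _+ₘ_
  infixl 7 _*ₘ_
  _+ₘ_ _*ₘ_ : ∀ {A} → A ⇒ ty → A ⇒ ty → A ⇒ ty
  f +ₘ g = mk (uncurry _⊕_) +-definable ∘ₘ ⟪ f , g ⟫
  f *ₘ g = mk (uncurry _⊛_) *-definable ∘ₘ ⟪ f , g ⟫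

  ⊖-unique : ∀ {x y} → x ⊕ (⊖ y) ≡ 0# → x ≡ y
  ⊖-unique {x} {y} eq = ⊕-cancelʳ (⊖ y) x y (trans eq (sym (⊖-inverseʳ y)))

  cancelˡ : ∀ {x y z} → x ≢ 0# → x ⊛ y ≡ x ⊛ z → y ≡ z
  cancelˡ {x} {y} {z} x≢0 eq with invertible x x≢0
  ... | x′ , xx′ = trans (sym (undo y)) (trans (cong (x′ ⊛_) eq) (undo z))
    where
    undo : ∀ w → x′ ⊛ (x ⊛ w) ≡ w
    undo w = trans (sym (⊛-assoc x′ x w))
      (trans (cong (_⊛ w) (trans (⊛-comm x′ x) xx′)) (⊛-identityˡ w))

  integral : ∀ {x y} → x ⊛ y ≡ 0# → x ≡ 0# ⊎ y ≡ 0#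
  integral {x} {y} eq with em {P = x ≡ 0#}
  ... | yes x≡0 = inj₁ x≡0
  ... | no x≢0  = inj₂ (cancelˡ x≢0 (trans eq (sym (⊛-zeroʳ x))))

-- Morley degree one of an infinite definable field.

module Connectedness (em : ∀ {a} → ExcludedMiddle a) {ℓ} (𝒰 : Universe ℓ) (fmr : FiniteMorleyRank 𝒰)
                     (F : DefinableField 𝒰) where
  open Classical em
  open Definability 𝒰
  open Universe 𝒰
  open FiniteMorleyRank fmr
  open Rank em 𝒰 fmr
  open FieldProperties em 𝒰 F

  Full : Pred ⟦ ty ⟧ ℓ
  Full _ = ⊤

  Generic : Pred ⟦ ty ⟧ ℓ → Set ℓ
  Generic = Ge ty (rk ty Full)

  -- By the monotonicity axiom the rank of the field would exceed itself.
  no-disjoint-sequence : (X : ℕ → Pred ⟦ ty ⟧ ℓ) → (∀ i → Generic (X i)) →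
    ¬ (∀ {i j} → i < j → Empty (X i ∩ X j))
  no-disjoint-sequence X gen disjoint =
    1+n≰n (proj₂ (proj₂ (Ge-from-sequence full X gen _ disjoint)))

  -- Such a `Y` stands for a generic type, namely that of the definable sets `A` with
  -- `Generic (Y ∩ A)`.
  DegreeOne : Pred ⟦ ty ⟧ ℓ → Set (lsuc ℓ)
  DegreeOne Y = Generic Y × (∀ {A} → Definable ty A → Generic (Y ∩ A) → ¬ Generic (Y ∩ ∁ A))

  -- Otherwise every generic set splits into two generic halves. Keeping one half and splitting it
  -- again forever, the halves left behind form a disjoint sequence of generic sets.
  DegreeOne-exists : Satisfiable DegreeOne
  DegreeOne-exists = dne λ none → let open Splitting none in
    no-disjoint-sequence Z (λ i → proj₂ (proj₂ (proj₂ (split (Y i)))))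
      (λ i<j x ((_ , ¬A) , (Yj , _)) → ¬A (decreasing i<j Yj))
    where
    module Splitting (none : ¬ Satisfiable DegreeOne) where
      split : ((Y , _) : Σ[ Y ∈ Pred ⟦ ty ⟧ ℓ ] Generic Y) →
              ∃[ A ] (Definable ty A × Generic (Y ∩ A) × Generic (Y ∩ ∁ A))
      split (Y , gen) = dne λ unsplit → none (Y , gen , λ def g g′ → unsplit (_ , def , g , g′))

      Y : ℕ → Σ[ Y ∈ Pred ⟦ ty ⟧ ℓ ] Generic Y
      Y zero    = Full , full , (0# , tt) , ≤-refl
      Y (suc n) = let A , _ , g , _ = split (Y n) in proj₁ (Y n) ∩ A , g

      Z : ℕ → Pred ⟦ ty ⟧ ℓ
      Z n = proj₁ (Y n) ∩ ∁ (proj₁ (split (Y n)))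

      decreasing : ∀ {i j} → i < j → proj₁ (Y j) ⊆ proj₁ (split (Y i))
      decreasing {i} {suc j} (s≤s i≤j) (Yj , Aj) with m≤n⇒m<n∨m≡n i≤j
      ... | inj₁ i<j  = decreasing i<j Yj
      ... | inj₂ refl = Aj

  infix 4 _~_
  -- Between sets of degree one this says that they determine the same generic type.
  _~_ : Pred ⟦ ty ⟧ ℓ → Pred ⟦ ty ⟧ ℓ → Set ℓ
  Y ~ Y′ = Generic (Y ∩ Y′)

  ~-sym : ∀ {Y Y′} → Y ~ Y′ → Y′ ~ Y
  ~-sym g@(def , _) = Ge-mono (λ (p , q) → q , p)
    (extensional ((λ (p , q) → q , p) , λ (p , q) → q , p) def) g

  -- Since `Y ∩ Y′` is generic, `Y` outside `Y′` is not, so the generic set `Y ∩ Y″` must keep its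
  -- rank inside `Y′`.
  DegreeOne-euclidean : ∀ {Y Y′ Y″} → DegreeOne Y → Definable ty Y′ → Definable ty Y″ →
    Y ~ Y′ → Y ~ Y″ → Y′ ~ Y″
  DegreeOne-euclidean ((Y-def , _) , unsplit) def′ def″ g′ g″ with Ge-split _ def′ g″
  ... | inj₁ g = Ge-mono (λ ((_ , y″) , y′) → y′ , y″) (intersections def′ def″) g
  ... | inj₂ g = ⊥-elim (unsplit def′ g′
    (Ge-mono (λ ((y , _) , ¬y′) → y , ¬y′) (intersections Y-def (complements def′)) g))

  -- Given infinitely many inequivalent sets of degree one, remove from each all the earlier ones.
  -- Each removal keeps the set generic, and the results are disjoint. The conjunct `DegreeOne Y′`
  -- ensures that only list entries of degree one serve as representatives.
  finitely-many-types :
    ∃[ ys ] (∀ Y → DegreeOne Y → Any (λ Y′ → Y ~ Y′ × DegreeOne Y′) ys)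
  finitely-many-types = dne λ inf → let open Sequence inf in
    no-disjoint-sequence (λ n → Rest n (Y n)) (λ n → Rest-generic n n ≤-refl)
      (λ {i} {j} i<j x (ri , rj) → Rest-avoids {n = j} {P = Y j} i<j rj (Rest-⊆ i {Y i} ri))
    where
    module Sequence (inf : InfiniteModulo DegreeOne (λ Y Y′ → Y ~ Y′ × DegreeOne Y′)) where
      Y = enum inf

      Y-def : ∀ n → Definable ty (Y n)
      Y-def n = proj₁ (proj₁ (enum-∈ inf n))

      Rest : ℕ → Pred ⟦ ty ⟧ ℓ → Pred ⟦ ty ⟧ ℓ
      Rest zero    P = P
      Rest (suc i) P = Rest i P ∩ ∁ (Y i)

      Rest-⊆ : ∀ n {P} → Rest n P ⊆ P
      Rest-⊆ zero    p       = p
      Rest-⊆ (suc n) {P} (p , _) = Rest-⊆ n {P} p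

      Rest-avoids : ∀ {i n P x} → i < n → Rest n P x → ¬ Y i x
      Rest-avoids {i} {suc n} {P} (s≤s i≤n) (p , ¬y) with m≤n⇒m<n∨m≡n i≤n
      ... | inj₁ i<n  = Rest-avoids {P = P} i<n p
      ... | inj₂ refl = ¬y

      Rest-generic : ∀ i n → i ≤ n → Generic (Rest i (Y n))
      Rest-generic zero    n _   = proj₁ (enum-∈ inf n)
      Rest-generic (suc i) n i<n with Ge-split _ (Y-def i) (Rest-generic i n (<⇒≤ i<n))
      ... | inj₂ g = g
      ... | inj₁ g = ⊥-elim (enum-new inf i<n
        ( Ge-mono (λ (r , y) → Rest-⊆ i {Y n} r , y) (intersections (Y-def n) (Y-def i)) g
        , enum-∈ inf i))

  record Permutation : Set ℓ where
    constructor perm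
    field
      to from : ty ⇒ ty
      to-from : ∀ x → fun to (fun from x) ≡ x
      from-to : ∀ x → fun from (fun to x) ≡ x
  open Permutation

  inverse : Permutation → Permutation
  inverse (perm g h gh hg) = perm h g hg gh

  translation : ⟦ ty ⟧ → Permutation
  translation b = perm (coord idᶜ +ₘ const b) (coord idᶜ +ₘ const (⊖ b))
    (λ x → trans (⊕-assoc x (⊖ b) b) (trans (cong (x ⊕_) (⊖-inverseˡ b)) (⊕-identityʳ x)))
    (λ x → trans (⊕-assoc x b (⊖ b)) (trans (cong (x ⊕_) (⊖-inverseʳ b)) (⊕-identityʳ x)))

  scaling : ∀ c c′ → c ⊛ c′ ≡ 1# → Permutation
  scaling c c′ eq = perm (const c *ₘ coord idᶜ) (const c′ *ₘ coord idᶜ)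
    (λ x → trans (sym (⊛-assoc c c′ x)) (trans (cong (_⊛ x) eq) (⊛-identityˡ x)))
    (λ x → trans (sym (⊛-assoc c′ c x)) (trans (cong (_⊛ x) (trans (⊛-comm c′ c) eq)) (⊛-identityˡ x)))

  Generic-∘ : ∀ {Y} (π : Permutation) → Generic Y → Generic (Y ∘ fun (to π))
  Generic-∘ {Y} π gen@(def , _) = Ge-injective (from π) (preimage (to π) def) gen
    (λ {y} Yy → subst Y (sym (to-from π y)) Yy)
    (λ {y} {y′} _ _ eq → trans (sym (to-from π y)) (trans (cong (fun (to π)) eq) (to-from π y′)))

  DegreeOne-∘ : ∀ {Y} (π : Permutation) → DegreeOne Y → DegreeOne (Y ∘ fun (to π))
  DegreeOne-∘ {Y} π (gen@(def , _) , unsplit) = Generic-∘ π gen , λ A-def g g′ →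
    unsplit (preimage (from π) A-def) (back A-def g) (back (complements A-def) g′)
    where
    back : ∀ {A} → Definable ty A → Generic ((Y ∘ fun (to π)) ∩ A) → Generic (Y ∩ (A ∘ fun (from π)))
    back A-def g = Ge-mono (λ {x} (y , a) → subst Y (to-from π x) y , a)
      (intersections def (preimage (from π) A-def)) (Generic-∘ (inverse π) g)

  shift : ⟦ ty ⟧ → Pred ⟦ ty ⟧ ℓ → Pred ⟦ ty ⟧ ℓ
  shift b Y x = Y (x ⊕ b)

  shift-definable : ∀ {Y} b → Definable ty Y → Definable ty (shift b Y)
  shift-definable b = preimage (to (translation b))

  module _ (infinite : Infinite Full) where

    private
      Stable : Pred ⟦ ty ⟧ (lsuc ℓ) → Pred ⟦ ty ⟧ ℓ → Set (lsuc ℓ)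
      Stable X Y = DegreeOne Y → ∀ {b b′} → X b → X b′ → shift b Y ~ shift b′ Y

    -- One pigeonhole step for each listed `Y` of degree one: its shifts fall into finitely many
    -- types, so infinitely many of the remaining `b` send it to the same one. `X` lives one level
    -- up because `DegreeOne` quantifies over sets.
    stable-shifts : ∀ ys → Σ[ X ∈ Pred ⟦ ty ⟧ (lsuc ℓ) ] Infinite X × All (Stable X) ys
    stable-shifts [] = (λ _ → ⊤) , (λ (xs , cov) → infinite (xs , λ x _ → cov x tt)) , []
    stable-shifts (Y ∷ ys) = extend (stable-shifts ys) em
      where
      extend : (Σ[ X ∈ Pred ⟦ ty ⟧ (lsuc ℓ) ] Infinite X × All (Stable X) ys) → Dec (DegreeOne Y) →
               Σ[ X ∈ Pred ⟦ ty ⟧ (lsuc ℓ) ] Infinite X × All (Stable X) (Y ∷ ys)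
      extend (X , inf , stable) (no ¬deg) = X , inf , (λ deg → ⊥-elim (¬deg deg)) ∷ stable
      extend (X , inf , stable) (yes deg) =
        X′ , proj₂ refined
           , (λ _ {b} {b′} (_ , g , deg′) (_ , g′ , _) →
               DegreeOne-euclidean deg′ (shift-definable b Y-def) (shift-definable b′ Y-def)
                 (~-sym g) (~-sym g′))
             ∷ All.map weaken stable
        where
        Y-def = proj₁ (proj₁ deg)
        R : ⟦ ty ⟧ → Pred ⟦ ty ⟧ ℓ → Set (lsuc ℓ)
        R b Y′ = shift b Y ~ Y′ × DegreeOne Y′
        refined : ∃[ Y′ ] Infinite (λ x → X x × R x Y′)
        refined = pigeonhole {X = X} {R = R} inf (proj₁ finitely-many-types)
          (λ b _ → proj₂ finitely-many-types (shift b Y) (DegreeOne-∘ (translation b) deg))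
        X′ : Pred ⟦ ty ⟧ (lsuc ℓ)
        X′ x = X x × R x (proj₁ refined)
        weaken : ∀ {Z} → Stable X Z → Stable X′ Z
        weaken st d (x , _) (x′ , _) = st d x x′

    -- Two distinct shifts `b` and `b′` act alike on a representative of every type, so their
    -- difference fixes all the representatives, and with them every type.
    stabilising-shift : ∃[ d ] (d ≢ 0# × (∀ {Y} → DegreeOne Y → shift d Y ~ Y))
    stabilising-shift with finitely-many-types
    ... | ys , cover with stable-shifts ys
    ... | X , inf , stable = d , d≢0 , fixes
      where
      b = enum inf 0
      b′ = enum inf 1
      d = b ⊕ (⊖ b′)

      d≢0 : d ≢ 0#
      d≢0 eq = enum-injective inf {0} {1} (λ ()) (⊖-unique eq)

      fixes-representative : ∀ {Y} → DegreeOne Y → shift b Y ~ shift b′ Y → shift d Y ~ Y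
      fixes-representative {Y} ((def , _) , _) g = Ge-mono
        (λ {x} (p , q) → subst Y (rearrange x) p , subst Y (to-from (translation b′) x) q)
        (intersections (shift-definable d def) def) (Generic-∘ (inverse (translation b′)) g)
        where
        rearrange : ∀ x → x ⊕ (⊖ b′) ⊕ b ≡ x ⊕ d
        rearrange x = trans (⊕-assoc x (⊖ b′) b) (cong (x ⊕_) (⊕-comm (⊖ b′) b))

      fixes : ∀ {Y} → DegreeOne Y → shift d Y ~ Y
      fixes {Y} deg with lookupAny stable (cover Y deg)
      -- With `R` the representative of `Y`, the chain is `shift d Y ~ shift d R ~ R ~ Y`.
      ... | st , Y~R , degR = DegreeOne-euclidean degR (shift-definable d def) def
        (~-sym (DegreeOne-euclidean (DegreeOne-∘ (translation d) degR) (shift-definable d def) defR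
          (~-sym (Generic-∘ (translation d) Y~R))
          (fixes-representative degR (st degR (enum-∈ inf 0) (enum-∈ inf 1)))))
        (~-sym Y~R)
        where
        def = proj₁ (proj₁ deg)
        defR = proj₁ (proj₁ degR)

    -- Multiplication by `c` permutes the sets of degree one and turns the shift by `d` into the
    -- shift by `c ⊛ d`. For `a` non-zero take `c = a d⁻¹`.
    shift-invariant : ∀ {Y} a → DegreeOne Y → shift a Y ~ Y
    shift-invariant {Y} a deg@((def , sat , r) , _) = byCases em
      where
      d = proj₁ stabilising-shift
      fixes : ∀ {Z} → DegreeOne Z → shift d Z ~ Z
      fixes = proj₂ (proj₂ stabilising-shift)
      def′ : Definable ty (shift a Y ∩ Y)
      def′ = intersections (shift-definable a def) def

      rescale : ∀ c c′ → c ⊛ c′ ≡ 1# → c ⊛ d ≡ a → shift a Y ~ Y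
      rescale c c′ cc′ cd≡a = Ge-mono
        (λ {x} (p , q) → subst Y (trans (⊛-distribˡ c _ d) (cong₂ _⊕_ (to-from π x) cd≡a)) p
                       , subst Y (to-from π x) q)
        def′ (Generic-∘ {shift d (Y ∘ fun (to π)) ∩ (Y ∘ fun (to π))} (inverse π) (fixes (DegreeOne-∘ {Y} π deg)))
        where π = scaling c c′ cc′

      byCases : Dec (a ≡ 0#) → shift a Y ~ Y
      byCases (yes a≡0) = Ge-mono
        (λ {x} y → subst Y (sym (trans (cong (x ⊕_) a≡0) (⊕-identityʳ x))) y , y) def′ (def , sat , r)
      byCases (no a≢0) =
        let a′ , aa′ = invertible a a≢0
            d′ , dd′ = invertible d (proj₁ (proj₂ stabilising-shift))
        in rescale (a ⊛ d′) (d ⊛ a′)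
             (trans (⊛-assoc a d′ (d ⊛ a′)) (trans (cong (a ⊛_) (trans (sym (⊛-assoc d′ d a′))
               (trans (cong (_⊛ a′) (trans (⊛-comm d′ d) dd′)) (⊛-identityˡ a′)))) aa′))
             (trans (⊛-assoc a d′ d) (trans (cong (a ⊛_) (trans (⊛-comm d′ d) dd′)) (⊛-identityʳ a)))

    private
      N = rk ty Full

      rk≤N : ∀ {Q} → Definable ty Q → Satisfiable Q → rk ty Q ≤ N
      rk≤N Q-def sat = rk-mono Q-def full sat _

    -- If ∁ Y were generic, then {(x , a) ∣ x ∈ Y, x + a ∉ Y} would have rank 2N,
    -- so a single shift a would move generically many points of Y out of Y.
    DegreeOne-cosmall : ∀ {Y} → DegreeOne Y → ¬ Generic (∁ Y)
    DegreeOne-cosmall {Y} deg@((Y-def , (y , Yy) , N≤rkY) , unsplit) cogeneric =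
      unsplit (shift-definable a Y-def) (~-sym (shift-invariant a deg))
        (Ge-injective (coord π₁) (intersections Y-def (complements (shift-definable a Y-def))) generic-fibre
          (λ { ((Yx , ¬Yxa) , refl) → Yx , ¬Yxa })
          (λ { (_ , refl) (_ , refl) refl → refl }))
      where
      E : Pred ⟦ ty ⊗ ty ⟧ ℓ
      E (x , a) = Y x × ¬ Y (x ⊕ a)

      E-def : Definable (ty ⊗ ty) E
      E-def = intersections (coordinates π₁ Y-def)
                (preimage (coord π₁ +ₘ coord π₂) (complements Y-def))

      slice-generic : ∀ x → Generic (λ a → ¬ Y (x ⊕ a))
      slice-generic x = Ge-mono (λ {a} ¬Ya → subst (∁ Y) (⊕-comm a x) ¬Ya)
        (preimage (const x +ₘ coord idᶜ) (complements Y-def)) (Generic-∘ (translation x) cogeneric)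

      onto : ∀ {x} → Y x → Satisfiable (Fibre (coord π₁) E-def x)
      onto {x} Yx = let a , ¬Yxa = proj₁ (proj₂ (slice-generic x)) in (x , a) , (Yx , ¬Yxa) , refl

      rk-slice : ∀ {x} → Y x → rk (ty ⊗ ty) (Fibre (coord π₁) E-def x) ≡ N
      rk-slice {x} Yx = let slice-def , sat , N≤ = slice-generic x in trans
        (rk-injective (coord π₂) (Fibre-definable (coord π₁) E-def x) slice-def (onto Yx)
          (λ { ((_ , ¬Yxa) , refl) → ¬Yxa })
          (λ {a} ¬Yxa → (x , a) , ((Yx , ¬Yxa) , refl) , refl)
          (λ { (_ , refl) (_ , refl) refl → refl }))
        (≤-antisym (rk≤N slice-def sat) N≤)

      E-large : Ge (ty ⊗ ty) (N + N) E
      E-large = let a , ¬Yya = proj₁ (proj₂ (slice-generic y)) in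
        E-def , ((y , a) , Yy , ¬Yya) ,
        ≤-trans (+-monoˡ-≤ N N≤rkY) (≤-reflexive (sym
          (rk-additive (coord π₁) E-def Y-def ((y , a) , Yy , ¬Yya) proj₁ onto N rk-slice)))

      large-fibre : ∃[ a ] Ge (ty ⊗ ty) N (Fibre (coord π₂) E-def a)
      large-fibre = Ge-fibre (coord π₂) E-def E-large rk≤N
      a = proj₁ large-fibre
      generic-fibre = proj₂ large-fibre

    -- Take any `Y` of degree one. As `∁ Y` is not generic, every generic set meets `Y` generically,
    -- so two complementary generic sets would split `Y`.
    connected : ∀ {A} → Definable ty A → Generic A → ¬ Generic (∁ A)
    connected {A} A-def g g′ = let Y , deg@((Y-def , _) , unsplit) = DegreeOne-exists in
      unsplit A-def (meets deg Y-def g) (meets deg Y-def g′)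
      where
      meets : ∀ {Y B} → DegreeOne Y → Definable ty Y → Generic B → Generic (Y ∩ B)
      meets deg Y-def g with Ge-split _ Y-def g
      ... | inj₁ h = ~-sym h
      ... | inj₂ h = ⊥-elim (DegreeOne-cosmall deg (Ge-mono proj₂ (complements Y-def) h))

-- Linear forms and polynomials with definable coefficient tuples.

module Polynomials (em : ∀ {a} → ExcludedMiddle a) {ℓ} (𝒰 : Universe ℓ) (F : DefinableField 𝒰) where
  open Classical em
  open Definability 𝒰
  open Universe 𝒰
  open FieldProperties em 𝒰 F
  open Solver using (solve; _:=_; _:+_; _:*_)

  Tuple : ℕ → Set ℓ
  Tuple n = ⟦ ty ^⁺ n ⟧

  linearₘ : ∀ n → ty ^⁺ n ⊗ ty ^⁺ n ⇒ ty
  linearₘ zero    = coord π₁ *ₘ coord π₂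
  linearₘ (suc n) = coord (π₁ ∘ᶜ π₁) *ₘ coord (π₁ ∘ᶜ π₂)
                      +ₘ linearₘ n ∘ₘ coord ⟨ π₂ ∘ᶜ π₁ , π₂ ∘ᶜ π₂ ⟩

  linear : ∀ n → Tuple n → Tuple n → ⟦ ty ⟧
  linear n c e = fun (linearₘ n) (c , e)

  combine : ∀ n → ⟦ ty ⟧ → ⟦ ty ⟧ → Tuple n → Tuple n → Tuple n
  combine zero    s t c        c′         = s ⊛ c ⊕ t ⊛ c′
  combine (suc n) s t (c , cs) (c′ , cs′) = s ⊛ c ⊕ t ⊛ c′ , combine n s t cs cs′

  linear-combine : ∀ n s t c c′ e →
    linear n (combine n s t c c′) e ≡ s ⊛ linear n c e ⊕ t ⊛ linear n c′ e
  linear-combine zero s t c c′ e = solve 5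
    (λ s t c c′ e → (s :* c :+ t :* c′) :* e := s :* (c :* e) :+ t :* (c′ :* e)) refl s t c c′ e
  linear-combine (suc n) s t (c , cs) (c′ , cs′) (e , es) = trans
    (cong ((s ⊛ c ⊕ t ⊛ c′) ⊛ e ⊕_) (linear-combine n s t cs cs′ es))
    (solve 7 (λ s t c c′ e x x′ →
        (s :* c :+ t :* c′) :* e :+ (s :* x :+ t :* x′) := s :* (c :* e :+ x) :+ t :* (c′ :* e :+ x′))
      refl s t c c′ e (linear n cs es) (linear n cs′ es))

  -- Horner evaluation of c₀ + c₁ X + ⋯ + cₙ Xⁿ: the degree is at most `n`, whereas `monic n` has
  -- degree n + 1.
  polyₘ : ∀ n → ty ^⁺ n ⊗ ty ⇒ ty
  polyₘ zero    = coord π₁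
  polyₘ (suc n) = coord (π₁ ∘ᶜ π₁) +ₘ coord π₂ *ₘ polyₘ n ∘ₘ coord ⟨ π₂ ∘ᶜ π₁ , π₂ ⟩

  poly : ∀ n → Tuple n → ⟦ ty ⟧ → ⟦ ty ⟧
  poly n c y = fun (polyₘ n) (c , y)

  monicₘ : ∀ n → ty ^⁺ n ⊗ ty ⇒ ty
  monicₘ zero    = coord π₁ +ₘ coord π₂
  monicₘ (suc n) = coord (π₁ ∘ᶜ π₁) +ₘ coord π₂ *ₘ monicₘ n ∘ₘ coord ⟨ π₂ ∘ᶜ π₁ , π₂ ⟩

  -- The value at y of the polynomial c₀ + c₁ X + ⋯ + cₙ Xⁿ + Xⁿ⁺¹.
  monic : ∀ n → Tuple n → ⟦ ty ⟧ → ⟦ ty ⟧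
  monic n c y = fun (monicₘ n) (c , y)

  -- Synthetic division by X - z: the coefficients of the quotient are the intermediate values of
  -- Horner's scheme at `z`.
  quotient : ∀ n → Tuple (suc n) → ⟦ ty ⟧ → Tuple n
  quotient zero    (_ , f) z = monic zero f z
  quotient (suc n) (_ , f) z = monic (suc n) f z , quotient n f z

  -- f(y) − f(z) = (y − z) q(y), without subtraction.
  quotient-spec : ∀ n f y z → let q = monic n (quotient n f z) y in
    monic (suc n) f y ⊕ z ⊛ q ≡ y ⊛ q ⊕ monic (suc n) f z
  quotient-spec zero (c , f) y z = solve 4
    (λ c f y z → (c :+ y :* (f :+ y)) :+ z :* ((f :+ z) :+ y)
              := y :* ((f :+ z) :+ y) :+ (c :+ z :* (f :+ z))) refl c f y z
  quotient-spec (suc n) (c , f) y z = trans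
    (solve 6 (λ c y z fy fz q → (c :+ y :* fy) :+ z :* (fz :+ y :* q)
                             := (c :+ z :* fz) :+ y :* (fy :+ z :* q)) refl c y z fy fz q)
    (trans (cong (λ w → (c ⊕ z ⊛ fz) ⊕ y ⊛ w) (quotient-spec n f y z))
      (solve 5 (λ c y z fz q → (c :+ z :* fz) :+ y :* (y :* q :+ fz)
                            := y :* (fz :+ y :* q) :+ (c :+ z :* fz)) refl c y z fz q))
    where
    fy = monic (suc n) f y
    fz = monic (suc n) f z
    q = monic n (quotient n f z) y

  -- Divide by one root `z`. At another root `y` the division identity becomes `z ⊛ q ≡ y ⊛ q`, so
  -- either the quotient vanishes at `y` or `q` cancels.
  finite-roots : ∀ n f → Finite (λ y → monic n f y ≡ 0#)
  finite-roots zero f = ⊖ f ∷ [] , λ y eq → here (⊕-cancelˡ f y (⊖ f) (trans eq (sym (⊖-inverseʳ f))))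
  finite-roots (suc n) f with em {P = ∃[ z ] monic (suc n) f z ≡ 0#}
  ... | no none = [] , λ y eq → ⊥-elim (none (y , eq))
  ... | yes (z , fz≡0) = z ∷ proj₁ rest , covers
    where
    rest = finite-roots n (quotient n f z)
    covers : ∀ y → monic (suc n) f y ≡ 0# → Any (y ≡_) (z ∷ proj₁ rest)
    covers y fy≡0 with em {P = monic n (quotient n f z) y ≡ 0#}
    ... | yes q≡0 = there (proj₂ rest y q≡0)
    ... | no q≢0  = here (cancelˡ q≢0 (trans (⊛-comm q y) (trans (sym zq≡yq) (⊛-comm z q))))
      where
      q = monic n (quotient n f z) y
      zq≡yq : z ⊛ q ≡ y ⊛ q
      zq≡yq = trans (sym (⊕-identityˡ _)) (trans (cong (_⊕ z ⊛ q) (sym fy≡0))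
        (trans (quotient-spec n f y z) (trans (cong (y ⊛ q ⊕_) fz≡0) (⊕-identityʳ _))))

  addConstantₘ : ∀ n → ty ⊗ ty ^⁺ n ⇒ ty ^⁺ n
  addConstantₘ zero    = coord π₁ +ₘ coord π₂
  addConstantₘ (suc n) = ⟪ coord π₁ +ₘ coord (π₁ ∘ᶜ π₂) , coord (π₂ ∘ᶜ π₂) ⟫

  monic-addConstant : ∀ n a f y → monic n (fun (addConstantₘ n) (a , f)) y ≡ a ⊕ monic n f y
  monic-addConstant zero    a f y = ⊕-assoc a f y
  monic-addConstant (suc n) a f y = ⊕-assoc a _ _

  -- The coefficients of (X + a) f. For f = c + X g they come from (X + a) f = a c + X (c + (X + a)
  -- g).
  multiplyₘ : ∀ n → ty ⊗ ty ^⁺ n ⇒ ty ^⁺ suc n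
  multiplyₘ zero    = ⟪ coord π₁ *ₘ coord π₂ , coord π₁ +ₘ coord π₂ ⟫
  multiplyₘ (suc n) = ⟪ coord π₁ *ₘ coord (π₁ ∘ᶜ π₂)
                      , addConstantₘ (suc n) ∘ₘ ⟪ coord (π₁ ∘ᶜ π₂) , multiplyₘ n ∘ₘ coord ⟨ π₁ , π₂ ∘ᶜ π₂ ⟩ ⟫ ⟫

  monic-multiply : ∀ n a f y → monic (suc n) (fun (multiplyₘ n) (a , f)) y ≡ (y ⊕ a) ⊛ monic n f y
  monic-multiply zero a f y = solve 3
    (λ a f y → a :* f :+ y :* ((a :+ f) :+ y) := (y :+ a) :* (f :+ y)) refl a f y
  monic-multiply (suc n) a (c , f) y = trans
    (cong (λ w → a ⊛ c ⊕ y ⊛ w)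
      (trans (monic-addConstant (suc n) c (fun (multiplyₘ n) (a , f)) y) (cong (c ⊕_) (monic-multiply n a f y))))
    (solve 4 (λ a c y w → a :* c :+ y :* (c :+ (y :+ a) :* w) := (y :+ a) :* (c :+ y :* w))
      refl a c y (monic n f y))

  splitₘ : ∀ n → ty ^⁺ n ⇒ ty ^⁺ n
  splitₘ zero    = coord idᶜ
  splitₘ (suc n) = multiplyₘ n ∘ₘ ⟪ coord π₁ , splitₘ n ∘ₘ coord π₂ ⟫

  -- The coefficients of (X + a₀) ⋯ (X + aₙ).
  split : ∀ n → Tuple n → Tuple n
  split n = fun (splitₘ n)

  AllOf-⊆ : ∀ {P Q : Pred ⟦ ty ⟧ ℓ} n → P ⊆ Q → ∀ {as} → AllOf {ty} P n as → AllOf {ty} Q n as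
  AllOf-⊆ zero    P⊆Q p        = P⊆Q p
  AllOf-⊆ (suc n) P⊆Q (p , ps) = P⊆Q p , AllOf-⊆ n P⊆Q ps

  AllOf-finite : ∀ {P : Pred ⟦ ty ⟧ ℓ} n → Finite P → Finite (AllOf {ty} P n)
  AllOf-finite zero    fin = fin
  AllOf-finite (suc n) fin@(xs , cov) = let ys , cov′ = AllOf-finite n fin in
    cartesianProduct xs ys , λ (a , as) (p , ps) → ∈-cartesianProduct⁺ (cov a p) (cov′ as ps)

  split-roots : ∀ n as → AllOf {ty} (λ a → monic n (split n as) (⊖ a) ≡ 0#) n as
  split-roots zero    a        = ⊖-inverseʳ a
  split-roots (suc n) (a , as) =
    trans (monic-multiply n a (split n as) (⊖ a)) (trans (cong (_⊛ monic n (split n as) (⊖ a)) (⊖-inverseˡ a)) (⊛-zeroˡ _)) ,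
    AllOf-⊆ n (λ {b} eq → trans (monic-multiply n a (split n as) (⊖ b))
                (trans (cong ((⊖ b ⊕ a) ⊛_) eq) (⊛-zeroʳ _))) (split-roots n as)

  -- Every entry of a tuple in the fibre is minus a root of `f`, and `f` has finitely many roots.
  split-finite-fibres : ∀ n f → Finite (λ as → split n as ≡ f)
  split-finite-fibres n f =
    let xs , cov   = finite-roots n f
        ys , cov′ = AllOf-finite {λ a → monic n f (⊖ a) ≡ 0#} n
          (map ⊖_ xs , λ a eq → subst (λ w → Any (w ≡_) (map ⊖_ xs)) (⊖-involutive a) (∈-map⁺ ⊖_ (cov (⊖ a) eq)))
    in ys , λ { as refl → cov′ as (split-roots n as) }

  -- A field has no zero divisors, so a root of the product is a root of one of the factors X + aᵢ.
  split-root : ∀ n as y → monic n (split n as) y ≡ 0# → ∀ {P : Pred ⟦ ty ⟧ ℓ} → AllOf {ty} P n as → ∃[ a ] (P a × y ≡ ⊖ a)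
  split-root zero a y eq p = a , p , ⊕-cancelˡ a y (⊖ a) (trans eq (sym (⊖-inverseʳ a)))
  split-root (suc n) (a , as) y eq (p , ps) with integral (trans (sym (monic-multiply n a (split n as) y)) eq)
  ... | inj₁ y+a≡0 = a , p , ⊕-cancelʳ a y (⊖ a) (trans y+a≡0 (sym (⊖-inverseˡ a)))
  ... | inj₂ eq′   = split-root n as y eq′ ps

-- Infinite definable subfields are improper.

module Subfields (em : ∀ {a} → ExcludedMiddle a) {ℓ} (𝒰 : Universe ℓ) (fmr : FiniteMorleyRank 𝒰)
                 (F : DefinableField 𝒰) where
  open Classical em
  open Definability 𝒰
  open Universe 𝒰
  open FiniteMorleyRank fmr
  open Rank em 𝒰 fmr
  open FieldProperties em 𝒰 F
  open Connectedness em 𝒰 fmr F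
  open Polynomials em 𝒰 F
  open Solver using (solve; _:=_; _:+_; _:*_)

  record IsInfiniteSubfield (k : Pred ⟦ ty ⟧ ℓ) : Set ℓ where
    field
      definable : Definable ty k
      infinite  : Infinite k
      1-∈       : k 1#
      ⊕-∈       : ∀ {x y} → k x → k y → k (x ⊕ y)
      ⊛-∈       : ∀ {x y} → k x → k y → k (x ⊛ y)
      ⊖-∈       : ∀ {x} → k x → k (⊖ x)
      inverse-∈ : ∀ {x y} → k x → x ⊛ y ≡ 1# → k y

  module _ {k : Pred ⟦ ty ⟧ ℓ} (isSubfield : IsInfiniteSubfield k) where
    open IsInfiniteSubfield isSubfield

    0-∈ : k 0#
    0-∈ = subst k (⊖-inverseʳ 1#) (⊕-∈ 1-∈ (⊖-∈ 1-∈))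

    k^ : ∀ n → Pred (Tuple n) ℓ
    k^ = AllOf {ty} k

    k^-definable : ∀ n → Definable (ty ^⁺ n) (k^ n)
    k^-definable = AllOf-definable definable

    k^-satisfiable : ∀ n → Satisfiable (k^ n)
    k^-satisfiable zero    = 0# , 0-∈
    k^-satisfiable (suc n) = let c , p = k^-satisfiable n in (0# , c) , 0-∈ , p

    rk-k^ : ℕ → ℕ
    rk-k^ n = rk (ty ^⁺ n) (k^ n)

    rk-k^-suc : ∀ n → rk-k^ (suc n) ≡ rk-k^ 0 + rk-k^ n
    rk-k^-suc n = rk-additive (coord π₁) (k^-definable (suc n)) definable (k^-satisfiable (suc n)) proj₁ onto
      (rk-k^ n) fibres
      where
      onto : ∀ {a} → k a → Satisfiable (Fibre (coord π₁) (k^-definable (suc n)) a)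
      onto {a} p = let c , q = k^-satisfiable n in (a , c) , (p , q) , refl
      fibres : ∀ {a} → k a → rk (ty ^⁺ suc n) (Fibre (coord π₁) (k^-definable (suc n)) a) ≡ rk-k^ n
      fibres {a} p = rk-injective (coord π₂) (Fibre-definable (coord π₁) (k^-definable (suc n)) a)
        (k^-definable n) (onto p) (λ ((_ , q) , _) → q) (λ {c} q → (a , c) , ((p , q) , refl) , refl)
        (λ { (_ , refl) (_ , refl) refl → refl })

    rk-k≥1 : 1 ≤ rk-k^ 0
    rk-k≥1 = proj₂ (proj₂ (infinite⇒Ge definable infinite))

    rk-k^-increasing : ∀ n → rk-k^ n < rk-k^ (suc n)
    rk-k^-increasing n = ≤-trans (+-monoˡ-≤ (rk-k^ n) rk-k≥1) (≤-reflexive (sym (rk-k^-suc n)))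

    -- `k^ n` has n + 1 coordinates, and each contributes the rank of the infinite set `k`, which is
    -- at least one.
    n<rk-k^n : ∀ n → n < rk-k^ n
    n<rk-k^n zero    = rk-k≥1
    n<rk-k^n (suc n) = ≤-trans (s≤s (n<rk-k^n n)) (rk-k^-increasing n)

    InjectiveOn : ∀ n → (Tuple n → ⟦ ty ⟧) → Set ℓ
    InjectiveOn n f = ∀ {c c′} → k^ n c → k^ n c′ → f c ≡ f c′ → c ≡ c′

    rk-k^-bound : ∀ n (f : ty ^⁺ n ⇒ ty) → InjectiveOn n (fun f) → rk-k^ n ≤ rk ty Full
    rk-k^-bound n f inj = proj₂ (proj₂
      (Ge-injective f full (k^-definable n , k^-satisfiable n , ≤-refl) _ inj))

    -- Linear independence over `k` of the n + 1 entries of `e`, put as injectivity because ranks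
    -- are compared along injections.
    Independent : ∀ n → Tuple n → Set ℓ
    Independent n e = InjectiveOn n (λ c → linear n c e)

    linearAtₘ : ∀ n → Tuple n → ty ^⁺ n ⇒ ty
    linearAtₘ n e = linearₘ n ∘ₘ ⟪ coord idᶜ , const e ⟫

    -- Starting from the single vector `1#`, the family is enlarged while possible. This stops
    -- because n < rk (`k^ n`) ≤ rk F for an independent family.
    maximal-independent : ∃[ n ] ∃[ e ] (Independent n e × (∀ e′ → ¬ Independent (suc n) e′))
    maximal-independent = search (rk ty Full) 0 1#
      (λ _ _ eq → trans (sym (⊛-identityʳ _)) (trans eq (⊛-identityʳ _))) ≤-refl
      where
      search : ∀ fuel n e → Independent n e → rk ty Full ≤ n + fuel →
        ∃[ n ] ∃[ e ] (Independent n e × (∀ e′ → ¬ Independent (suc n) e′))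
      -- Without fuel `le` reads rk F ≤ n, against n < rk F.
      search zero n e ind le = ⊥-elim (<⇒≱ (n<rk-k^n n)
        (≤-trans (rk-k^-bound n (linearAtₘ n e) ind) (≤-trans le (≤-reflexive (+-identityʳ n)))))
      search (suc fuel) n e ind le with em {P = ∃[ e′ ] Independent (suc n) e′}
      ... | yes (e′ , ind′) = search fuel (suc n) e′ ind′ (≤-trans le (≤-reflexive (+-suc n fuel)))
      ... | no none         = n , e , ind , λ e′ ind′ → none (e′ , ind′)

    combine-∈ : ∀ n {s t c c′} → k s → k t → k^ n c → k^ n c′ → k^ n (combine n s t c c′)
    combine-∈ zero    ks kt kc kc′ = ⊕-∈ (⊛-∈ ks kc) (⊛-∈ kt kc′)
    combine-∈ (suc n) ks kt (kc , kcs) (kc′ , kcs′) =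
      ⊕-∈ (⊛-∈ ks kc) (⊛-∈ kt kc′) , combine-∈ n ks kt kcs kcs′

    not-injective : ∀ n {f : Tuple n → ⟦ ty ⟧} → ¬ InjectiveOn n f →
      ∃[ c ] ∃[ c′ ] (k^ n c × k^ n c′ × f c ≡ f c′ × c ≢ c′)
    not-injective n ¬inj = dne λ none → ¬inj λ {c} {c′} p p′ eq → dne λ c≢c′ → none (c , c′ , p , p′ , eq , c≢c′)

    -- This is y = (A′ - A) / (c - c′). The solver works in semirings, so both sides are compared
    -- after adding `u′ ⊛ (c′ ⊛ y ⊕ A)`.
    solve-for : ∀ {c c′ y A A′ u′} → c ⊛ y ⊕ A ≡ c′ ⊛ y ⊕ A′ → (c ⊕ (⊖ c′)) ⊛ u′ ≡ 1# →
      u′ ⊛ A′ ⊕ (⊖ u′) ⊛ A ≡ y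
    solve-for {c} {c′} {y} {A} {A′} {u′} eq uu′ =
      ⊕-cancelʳ (u′ ⊛ (c′ ⊛ y ⊕ A)) _ _ (trans
        (solve 6 (λ u′ v′ A A′ c′ y → (u′ :* A′ :+ v′ :* A) :+ u′ :* (c′ :* y :+ A)
                                  := u′ :* (c′ :* y :+ A′) :+ (u′ :+ v′) :* A) refl u′ (⊖ u′) A A′ c′ y)
        (trans (cong₂ (λ p q → u′ ⊛ p ⊕ q ⊛ A) (sym eq) (⊖-inverseʳ u′))
        (trans (cong (u′ ⊛ (c ⊛ y ⊕ A) ⊕_) (⊛-zeroˡ A))
        (trans (⊕-identityʳ _)
        (trans (cong (λ w → u′ ⊛ (w ⊛ y ⊕ A)) c≡)
        (trans (solve 5 (λ u u′ c′ y A → u′ :* ((u :+ c′) :* y :+ A) := u :* u′ :* y :+ u′ :* (c′ :* y :+ A))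
                  refl (c ⊕ (⊖ c′)) u′ c′ y A)
          (cong (_⊕ u′ ⊛ (c′ ⊛ y ⊕ A)) (trans (cong (_⊛ y) uu′) (⊛-identityˡ y)))))))))
      where
      c≡ : c ≡ c ⊕ (⊖ c′) ⊕ c′
      c≡ = sym (trans (⊕-assoc c _ c′) (trans (cong (c ⊕_) (⊖-inverseˡ c′)) (⊕-identityʳ c)))

    -- Maximality gives a relation over `k` between `y` and the entries of `e`. The coefficient of
    -- `y` is non-zero, since otherwise `e` would be dependent, so the relation can be solved for
    -- `y`.
    spanning : ∀ n e → Independent n e → (∀ e′ → ¬ Independent (suc n) e′) →
      ∀ y → ∃[ c ] (k^ n c × linear n c e ≡ y)
    spanning n e ind maximal y with not-injective (suc n) (maximal (y , e))
    ... | (c , cs) , (c′ , cs′) , (p , ps) , (p′ , ps′) , eq , distinct =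
      combine n u′ (⊖ u′) cs′ cs , combine-∈ n ku′ (⊖-∈ ku′) ps′ ps ,
      trans (linear-combine n u′ (⊖ u′) cs′ cs e) (solve-for eq uu′)
      where
      u≢0 : c ⊕ (⊖ c′) ≢ 0#
      u≢0 u≡0 with ⊖-unique u≡0
      ... | refl = distinct (cong (c ,_) (ind ps ps′ (⊕-cancelˡ (c ⊛ y) _ _ eq)))
      u′ = proj₁ (invertible _ u≢0)
      uu′ = proj₂ (invertible _ u≢0)
      ku′ : k u′
      ku′ = inverse-∈ (⊕-∈ p (⊖-∈ p′)) uu′

    -- Values at y of the monic polynomials of degree j over k.
    data MonicValue (y : ⟦ ty ⟧) : ℕ → ⟦ ty ⟧ → Set ℓ where
      one  : MonicValue y 0 1#
      step : ∀ {j m c} → k c → MonicValue y j m → MonicValue y (suc j) (c ⊕ y ⊛ m)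

    MonicValue-monic : ∀ {y} n {m} → MonicValue y (suc n) m → ∃[ f ] (k^ n f × monic n f y ≡ m)
    MonicValue-monic {y} zero (step {c = c} kc one) = c , kc , cong (c ⊕_) (sym (⊛-identityʳ y))
    MonicValue-monic {y} (suc n) (step {c = c} kc v) =
      let f , kf , eq = MonicValue-monic n v in (c , f) , (kc , kf) , cong (λ w → c ⊕ y ⊛ w) eq

    -- Multiplication by a power of X keeps a polynomial monic and vanishing at `y`.
    MonicValue-raise : ∀ {y j} i → MonicValue y j 0# → MonicValue y (i + j) 0#
    MonicValue-raise zero v = v
    MonicValue-raise {y} (suc i) v = subst (MonicValue y _)
      (trans (⊕-identityˡ _) (⊛-zeroʳ y)) (step 0-∈ (MonicValue-raise i v))

    -- Here `a` is the leading coefficient of the difference, `j` its degree, and `m` the value at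
    -- `y` of the monic polynomial left after division by `a`.
    poly-difference : ∀ n y {c c′} → k^ n c → k^ n c′ → c ≢ c′ →
      ∃[ a ] ∃[ j ] ∃[ m ] (k a × a ≢ 0# × j ≤ n × MonicValue y j m × poly n c y ≡ poly n c′ y ⊕ a ⊛ m)
    poly-difference zero y {c} {c′} p p′ c≢c′ =
      c ⊕ (⊖ c′) , 0 , 1# , ⊕-∈ p (⊖-∈ p′) , c≢c′ ∘ ⊖-unique , z≤n , one ,
      sym (trans (cong (c′ ⊕_) (⊛-identityʳ _)) (readd c c′))
      where
      readd : ∀ c c′ → c′ ⊕ (c ⊕ (⊖ c′)) ≡ c
      readd c c′ = trans (⊕-comm c′ _) (trans (⊕-assoc c _ c′) (trans (cong (c ⊕_) (⊖-inverseˡ c′)) (⊕-identityʳ c)))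
    poly-difference (suc n) y {c , cs} {c′ , cs′} (p , ps) (p′ , ps′) distinct with em {P = cs ≡ cs′}
    ... | yes refl =
      c ⊕ (⊖ c′) , 0 , 1# , ⊕-∈ p (⊖-∈ p′) , (λ eq → distinct (cong (_, cs) (⊖-unique eq))) , z≤n , one ,
      sym (trans (cong (c′ ⊕ y ⊛ x ⊕_) (⊛-identityʳ _))
        (trans (solve 4 (λ c d c′ w → (c′ :+ w) :+ (c :+ d) := (c :+ w) :+ (c′ :+ d)) refl c (⊖ c′) c′ (y ⊛ x))
          (trans (cong (c ⊕ y ⊛ x ⊕_) (⊖-inverseʳ c′)) (⊕-identityʳ _))))
      where x = poly n cs y
    ... | no cs≢cs′ with poly-difference n y ps ps′ cs≢cs′
    ...   | a , j , m , ka , a≢0 , j≤n , v , eq =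
      a , suc j , _ , ka , a≢0 , s≤s j≤n ,
      -- The new constant coefficient of the monic polynomial is (c - c′) a⁻¹.
      step (⊛-∈ (⊕-∈ p (⊖-∈ p′)) (inverse-∈ ka aa′)) v ,
      trans (cong (λ w → c ⊕ y ⊛ w) eq) (sym (trans
        (solve 8 (λ c d c′ y x a a′ m →
            (c′ :+ y :* x) :+ a :* ((c :+ d) :* a′ :+ y :* m)
         := (a :* a′) :* (c :+ d) :+ c′ :+ y :* (x :+ a :* m)) refl c (⊖ c′) c′ y x a a′ m)
        (cong (_⊕ y ⊛ (x ⊕ a ⊛ m)) (trans (cong (λ w → w ⊛ (c ⊕ (⊖ c′)) ⊕ c′) aa′)
          (trans (cong (_⊕ c′) (⊛-identityˡ _))
            (trans (⊕-assoc c _ c′) (trans (cong (c ⊕_) (⊖-inverseˡ c′)) (⊕-identityʳ c))))))))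
      where
      x = poly n cs′ y
      a′ = proj₁ (invertible a a≢0)
      aa′ = proj₂ (invertible a a≢0)

    -- Polynomials of degree at most n + 1 have n + 2 coefficients, too large a rank for evaluation
    -- at `y` to be injective. Two of them with the same value differ by a multiple of a monic
    -- polynomial vanishing at `y`, whose degree is then raised to exactly n + 1.
    algebraic : ∀ n → rk ty Full ≡ rk-k^ n → ∀ y → ∃[ f ] (k^ n f × monic n f y ≡ 0#)
    algebraic n rk≡ y =
      let c , c′ , p , p′ , eq , distinct    = not-injective (suc n) {λ c → poly (suc n) c y} not-inj
          a , j , m , _ , a≢0 , j≤ , v , eq′ = poly-difference (suc n) y p p′ distinct
      in monic-root j≤ v (cancelˡ a≢0
           (trans (⊕-cancelˡ (poly (suc n) c′ y) _ _ (trans (sym eq′) (trans eq (sym (⊕-identityʳ _)))))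
                  (sym (⊛-zeroʳ a))))
      where
      not-inj : ¬ InjectiveOn (suc n) (λ c → poly (suc n) c y)
      not-inj inj = <⇒≱ (rk-k^-increasing n)
        (≤-trans (rk-k^-bound (suc n) (polyₘ (suc n) ∘ₘ ⟪ coord idᶜ , const y ⟫) inj) (≤-reflexive rk≡))

      -- The case `j = 0`, in which `m` is `1#` and the equation is absurd, goes through uniformly
      -- with the others.
      monic-root : ∀ {j m} → j ≤ suc n → MonicValue y j m → m ≡ 0# → ∃[ f ] (k^ n f × monic n f y ≡ 0#)
      monic-root {j} j≤ v m≡0 = MonicValue-monic n
        (subst (λ i → MonicValue y i 0#) (m∸n+n≡m j≤)
          (MonicValue-raise (suc n ∸ j) (subst (MonicValue y j) m≡0 v)))

    split-∈ : ∀ n {as} → k^ n as → k^ n (split n as)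
    split-∈ zero    p        = p
    split-∈ (suc n) (p , ps) = multiply-∈ n p (split-∈ n ps)
      where
      addConstant-∈ : ∀ n {a f} → k a → k^ n f → k^ n (fun (addConstantₘ n) (a , f))
      addConstant-∈ zero    ka kf        = ⊕-∈ ka kf
      addConstant-∈ (suc n) ka (kc , kf) = ⊕-∈ ka kc , kf

      multiply-∈ : ∀ n {a f} → k a → k^ n f → k^ (suc n) (fun (multiplyₘ n) (a , f))
      multiply-∈ zero    ka kf        = ⊛-∈ ka kf , ⊕-∈ ka kf
      multiply-∈ (suc n) ka (kc , kf) = ⊛-∈ ka kc , addConstant-∈ (suc n) kc (multiply-∈ n ka kf)

    F-infinite : Infinite Full
    F-infinite (xs , cov) = infinite (xs , λ x _ → cov x tt)

    -- If `k` is generic, so is its coset k - x, which lies outside `k`.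
    complement-generic : ∀ {x} → ¬ k x → Generic (∁ k)
    complement-generic {x} ¬kx with Ge-split _ definable (full , (0# , tt) , ≤-refl)
    ... | inj₂ g = Ge-mono proj₂ (complements definable) g
    ... | inj₁ g = Ge-mono shifted (complements definable) (Generic-∘ (translation x) (Ge-mono proj₂ definable g))
      where
      shifted : ∀ {z} → k (z ⊕ x) → ¬ k z
      shifted {z} kzx kz = ¬kx (subst k
        (trans (sym (⊕-assoc (⊖ z) z x)) (trans (cong (_⊕ x) (⊖-inverseˡ z)) (⊕-identityˡ x)))
        (⊕-∈ (⊖-∈ kz) kzx))

    -- Both the split polynomials and those with a root outside k would be
    -- generic among the monic polynomials of degree [F : k].
    improper : ∀ x → k x
    improper x = dne λ ¬kx → connected F-infinite A-def A-generic (B-generic ¬kx)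
      where
      n = proj₁ maximal-independent
      e = proj₁ (proj₂ maximal-independent)
      ind : Independent n e
      ind = proj₁ (proj₂ (proj₂ maximal-independent))

      rk≡ : rk ty Full ≡ rk-k^ n
      rk≡ = sym (rk-injective (linearAtₘ n e) (k^-definable n) full (k^-satisfiable n) _
        (λ {y} _ → spanning n e ind (proj₂ (proj₂ (proj₂ maximal-independent))) y) ind)

      Split : Pred (Tuple n) ℓ
      Split f = ∃[ as ] (k^ n as × split n as ≡ f)

      Split-def : Definable (ty ^⁺ n) Split
      Split-def = image-definable (splitₘ n) (k^-definable n)

      Split-large : Ge (ty ^⁺ n) (rk ty Full) Split
      Split-large =
        let as , p = k^-satisfiable n in
        Split-def , (split n as , as , p , refl) , ≤-reflexive (trans rk≡
          (rk-finite-fibres (splitₘ n) (k^-definable n) Split-def (as , p) (λ p → _ , p , refl) id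
            (λ f → let xs , cov = split-finite-fibres n f in xs , λ as (_ , eq) → cov as eq)))

      Split-⊆ : Split ⊆ k^ n
      Split-⊆ (as , p , refl) = split-∈ n p

      Split-roots : ∀ {f y} → Split f → monic n f y ≡ 0# → k y
      Split-roots (as , p , refl) eq with split-root n as _ eq p
      ... | a , ka , refl = ⊖-∈ ka

      -- Connectedness concerns subsets of F, so sets of polynomials are carried into F by the
      -- bijection that takes `e` as basis.
      A : Pred ⟦ ty ⟧ ℓ
      A z = ∃[ f ] (Split f × linear n f e ≡ z)

      A-def : Definable ty A
      A-def = image-definable (linearAtₘ n e) Split-def

      A-generic : Generic A
      A-generic = Ge-injective (linearAtₘ n e) A-def Split-large (λ s → _ , s , refl)
        (λ s s′ → ind (Split-⊆ s) (Split-⊆ s′))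

      WithRoot : Pred ⟦ ty ^⁺ n ⊗ ty ⟧ ℓ
      WithRoot (f , y) = k^ n f × ¬ k y × monic n f y ≡ 0#

      WithRoot-def : Definable (ty ^⁺ n ⊗ ty) WithRoot
      WithRoot-def = intersections (coordinates π₁ (k^-definable n))
        (intersections (coordinates π₂ (complements definable)) (equal (monicₘ n) (const 0#)))

      NonSplit : Pred (Tuple n) ℓ
      NonSplit f = ∃[ p ] (WithRoot p × proj₁ p ≡ f)

      NonSplit-def : Definable (ty ^⁺ n) NonSplit
      NonSplit-def = image-definable (coord π₁) WithRoot-def

      NonSplit-large : ¬ k x → Ge (ty ^⁺ n) (rk ty Full) NonSplit
      NonSplit-large ¬kx = NonSplit-def , (_ , proj₁ sat , proj₂ sat , refl) , ≤-trans large (≤-reflexive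
        (rk-finite-fibres (coord π₁) WithRoot-def NonSplit-def sat (λ w → _ , w , refl) id finite))
        where
        -- Projecting to the root covers the generic set `∁ k`, by `algebraic`. Projecting to the
        -- polynomial has finite fibres, so the rank passes to `NonSplit`.
        withRoot : Ge (ty ^⁺ n ⊗ ty) (rk ty Full) WithRoot
        withRoot = Ge-onto (coord π₂) WithRoot-def (complement-generic ¬kx)
          (λ {y} ¬ky → let f , kf , eq = algebraic n rk≡ y in (f , y) , (kf , ¬ky , eq) , refl)
        sat = proj₁ (proj₂ withRoot)
        large = proj₂ (proj₂ withRoot)
        finite : ∀ f → Finite (Fibre (coord π₁) WithRoot-def f)
        finite f = let ys , cov = finite-roots n f in
          map (f ,_) ys , λ { (_ , y) ((_ , _ , eq) , refl) → ∈-map⁺ (f ,_) (cov y eq) }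

      B-generic : ¬ k x → Generic (∁ A)
      B-generic ¬kx = Ge-injective (linearAtₘ n e) (complements A-def) (NonSplit-large ¬kx)
        (λ { ((f , y) , (kf , ¬ky , root) , refl) (f′ , s , eq) →
              ¬ky (Split-roots (subst Split (ind (Split-⊆ s) kf eq) s) root) })
        (λ { (_ , (kf , _) , refl) (_ , (kf′ , _) , refl) → ind kf kf′ })

-- Isomorphisms between infinite subfields of two fields.

module Correspondences (em : ∀ {a} → ExcludedMiddle a) {ℓ} (𝒰 : Universe ℓ) (fmr : FiniteMorleyRank 𝒰) where
  open Classical em
  open Definability 𝒰
  open Universe 𝒰

  module _ (K L : DefinableField 𝒰) where
    private
      module K = FieldProperties em 𝒰 K
      module L = FieldProperties em 𝒰 L

    -- The graph of an isomorphism between a subfield of `K` and a subfield of `L`. The subfields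
    -- are its two projections, and the conditions are symmetric in `K` and `L`.
    record IsCorrespondence (S : Pred ⟦ K.ty ⊗ L.ty ⟧ ℓ) : Set ℓ where
      field
        definable  : Definable (K.ty ⊗ L.ty) S
        infinite   : Infinite S
        1-related  : S (K.1# , L.1#)
        ⊕-related  : ∀ {a b a′ b′} → S (a , b) → S (a′ , b′) → S (a K.⊕ a′ , b L.⊕ b′)
        ⊛-related  : ∀ {a b a′ b′} → S (a , b) → S (a′ , b′) → S (a K.⊛ a′ , b L.⊛ b′)
        ⊖-related  : ∀ {a b} → S (a , b) → S (K.⊖ a , L.⊖ b)
        inverse-related : ∀ {a b a′ b′} → S (a , b) → a K.⊛ a′ ≡ K.1# → b L.⊛ b′ ≡ L.1# → S (a′ , b′)
        functional : ∀ {a b b′} → S (a , b) → S (a , b′) → b ≡ b′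
        injective  : ∀ {a a′ b} → S (a , b) → S (a′ , b) → a ≡ a′

      0-related : S (K.0# , L.0#)
      0-related = subst₂ (λ a b → S (a , b)) (K.⊖-inverseʳ K.1#) (L.⊖-inverseʳ L.1#)
        (⊕-related 1-related (⊖-related 1-related))

  module _ {K L : DefinableField 𝒰} {S} (isCorr : IsCorrespondence K L S) where
    private
      module K = FieldProperties em 𝒰 K
      module L = FieldProperties em 𝒰 L
    open IsCorrespondence isCorr

    converse : IsCorrespondence L K (S ∘ swap)
    converse = record
      { definable       = coordinates ⟨ π₂ , π₁ ⟩ definable
      ; infinite        = infinite-image infinite swap id (λ { _ _ refl → refl })
      ; 1-related       = 1-related
      ; ⊕-related       = ⊕-related
      ; ⊛-related       = ⊛-related
      ; ⊖-related       = ⊖-related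
      ; inverse-related = λ s p q → inverse-related s q p
      ; functional      = injective
      ; injective       = functional
      }

    -- The first projection of `S` is an infinite definable subfield, hence all of `K`. It contains
    -- inverses because, zero being related to zero, injectivity makes the partner of an invertible
    -- scalar non-zero.
    total : ∀ a → ∃[ b ] S (a , b)
    total = Subfields.improper em 𝒰 fmr K record
      { definable = projections definable
      ; infinite  = infinite-image infinite proj₁ (λ {(a , b)} s → b , s)
          (λ { {a , b} {_ , b′} s s′ refl → cong (a ,_) (functional s s′) })
      ; 1-∈ = _ , 1-related
      ; ⊕-∈ = λ (_ , s) (_ , s′) → _ , ⊕-related s s′
      ; ⊛-∈ = λ (_ , s) (_ , s′) → _ , ⊛-related s s′
      ; ⊖-∈ = λ (_ , s) → _ , ⊖-related s
      ; inverse-∈ = λ {a} {a′} (b , s) aa′ →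
          let b′ , bb′ = L.invertible b (nonzero s aa′) in b′ , inverse-related s aa′ bb′
      }
      where
      nonzero : ∀ {a a′ b} → S (a , b) → a K.⊛ a′ ≡ K.1# → b ≢ L.0#
      nonzero {a} {a′} s aa′ refl with injective s 0-related
      ... | refl = K.1≢0 (trans (sym aa′) (K.⊛-zeroˡ a′))

  module _ {K L : DefinableField 𝒰} {S} (isCorr : IsCorrespondence K L S) where
    private
      module K = FieldProperties em 𝒰 K
      module L = FieldProperties em 𝒰 L
    open IsCorrespondence isCorr

    onto : ∀ b → ∃[ a ] S (a , b)
    onto = total (converse isCorr)

    correspondence⇒≃ : _≃_ 𝒰 K L
    correspondence⇒≃ = f , record
      { isRingMonomorphism = record
        { isRingHomomorphism = record
          { isSemiringHomomorphism = record
            { isNearSemiringHomomorphism = record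
              { +-isMonoidHomomorphism = record
                { isMagmaHomomorphism = record
                  { isRelHomomorphism = record { cong = cong f }
                  ; homo = λ a a′ → value (⊕-related (rel a) (rel a′))
                  }
                ; ε-homo = value 0-related
                }
              ; *-homo = λ a a′ → value (⊛-related (rel a) (rel a′))
              }
            ; 1#-homo = value 1-related
            }
          ; -‿homo = λ a → value (⊖-related (rel a))
          }
        ; injective = λ {a} {a′} eq → injective (rel a) (subst (λ b → S (a′ , b)) (sym eq) (rel a′))
        }
      ; surjective = λ b → let a , s = onto b in a , λ { refl → value s }
      } , extensional (value , λ { refl → rel _ }) definable
      where
      f : ⟦ K.ty ⟧ → ⟦ L.ty ⟧
      f a = proj₁ (total isCorr a)
      rel : ∀ a → S (a , f a)
      rel a = proj₂ (total isCorr a)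
      value : ∀ {a b} → S (a , b) → f a ≡ b
      value s = functional (rel _) s

-- The three fields acting on maps from U × V to W.

module Scalars (em : ∀ {a} → ExcludedMiddle a) {ℓ} (𝒰 : Universe ℓ) (fmr : FiniteMorleyRank 𝒰)
               {K L M : DefinableField 𝒰}
               {U : DefinableVectorSpace 𝒰 K} {V : DefinableVectorSpace 𝒰 L} {W : DefinableVectorSpace 𝒰 M}
               (B : DefinableBiadditive 𝒰 U V W) (B≢0 : DefinableBiadditive.Nonzero B) where
  open Classical em
  open Definability 𝒰
  open Universe 𝒰
  open DefinableBiadditive B using (β; additiveˡ; additiveʳ)
  open Correspondences em 𝒰 fmr
  private
    module U where
      open DefinableVectorSpace U public
      open IsLeftModule isLeftModule public
    module V where
      open DefinableVectorSpace V public
      open IsLeftModule isLeftModule public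
    module W where
      open DefinableVectorSpace W public
      open IsLeftModule isLeftModule public
      group : Group ℓ ℓ
      group = record { isGroup = +ᴹ-isGroup }
      open GroupProperties group public using () renaming (∙-cancelˡ to +-cancelˡ; identityˡ-unique to +-identityˡ-unique)

  Map : Set ℓ
  Map = ⟦ U.ty ⟧ → ⟦ V.ty ⟧ → ⟦ W.ty ⟧

  infix 4 _≈_
  _≈_ : Map → Map → Set ℓ
  f ≈ g = ∀ u v → f u v ≡ g u v

  0ᴹ : Map
  0ᴹ _ _ = W.0ᵛ

  -- A common form for scaling the first argument, the second argument or the value. The
  -- multiplicative laws hold for all maps, but `·-⊕` is stated for `β` because scaling an argument
  -- is additive in the scalar only for bi-additive maps.
  record ScalarAction (A : DefinableField 𝒰) : Set ℓ where
    private module A = FieldProperties em 𝒰 A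
    infixr 7 _·_
    field
      _·_      : ⟦ A.ty ⟧ → Map → Map
      ·-cong   : ∀ a {f g} → f ≈ g → a · f ≈ a · g
      ·-1      : ∀ f → A.1# · f ≈ f
      ·-⊛      : ∀ a b f → (a A.⊛ b) · f ≈ a · b · f
      ·-0ᴹ     : ∀ a → a · 0ᴹ ≈ 0ᴹ
      ·-⊕      : ∀ a b u v → ((a A.⊕ b) · β) u v ≡ (a · β) u v W.+ᵛ (b · β) u v
      ·-definable : DefinableMap (A.ty ⊗ U.ty ⊗ V.ty) W.ty (λ (a , u , v) → (a · β) u v)

    ·-0 : A.0# · β ≈ 0ᴹ
    ·-0 u v = W.+-identityˡ-unique _ _
      (trans (sym (·-⊕ A.0# A.0# u v)) (cong (λ a → (a · β) u v) (A.⊕-identityˡ A.0#)))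

    ·-⊖ : ∀ a u v → (a · β) u v W.+ᵛ ((A.⊖ a) · β) u v ≡ W.0ᵛ
    ·-⊖ a u v = trans (sym (·-⊕ a (A.⊖ a) u v))
      (trans (cong (λ a → (a · β) u v) (A.⊖-inverseʳ a)) (·-0 u v))

    -- A non-zero scalar is invertible, so it cannot annihilate the non-zero map `β`.
    faithful : ∀ {a} → a · β ≈ 0ᴹ → a ≡ A.0#
    faithful {a} eq = dne λ a≢0 →
      let a′ , aa′ = A.invertible a a≢0
          u , v , βuv≢0 = B≢0
      in βuv≢0 (trans (sym (·-1 β u v))
           (trans (cong (λ c → (c · β) u v) (trans (sym aa′) (A.⊛-comm a a′)))
             (trans (·-⊛ a′ a β u v) (trans (·-cong a′ eq u v) (·-0ᴹ a′ u v)))))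

    ·-injective : ∀ {a a′} → a · β ≈ a′ · β → a ≡ a′
    ·-injective {a} {a′} eq = A.⊖-unique (faithful λ u v →
      trans (·-⊕ a (A.⊖ a′) u v) (trans (cong (W._+ᵛ ((A.⊖ a′) · β) u v) (eq u v)) (·-⊖ a′ u v)))

    ·-inverse : ∀ {a a′} → a A.⊛ a′ ≡ A.1# → ∀ f → a′ · a · f ≈ f
    ·-inverse {a} {a′} aa′ f u v = trans (sym (·-⊛ a′ a f u v))
      (trans (cong (λ c → (c · f) u v) (trans (A.⊛-comm a′ a) aa′)) (·-1 f u v))

  precomposeˡ : ScalarAction K
  precomposeˡ = record
    { _·_    = λ a f u v → f (a U.*ᵛ u) v
    ; ·-cong = λ a eq u v → eq _ v
    ; ·-1    = λ f u v → cong (λ u → f u v) (U.*ₗ-identityˡ u)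
    -- Precomposition reverses the order of the scalars, and commutativity of the field restores it.
    ; ·-⊛    = λ a b f u v → cong (λ u → f u v)
        (trans (cong (U._*ᵛ u) (K.⊛-comm a b)) (U.*ₗ-assoc b a u))
    ; ·-0ᴹ   = λ a u v → refl
    ; ·-⊕    = λ a b u v → trans (cong (λ u → β u v) (U.*ₗ-distribʳ u a b)) (additiveˡ _ _ v)
    ; ·-definable = graph (mk {U.ty ⊗ V.ty} (uncurry β) (DefinableBiadditive.definable B) ∘ₘ
        ⟪ mk {K.ty ⊗ U.ty} (uncurry U._*ᵛ_) U.*-definable ∘ₘ coord ⟨ π₁ , π₁ ∘ᶜ π₂ ⟩ , coord (π₂ ∘ᶜ π₂) ⟫)
    }
    where module K = FieldProperties em 𝒰 K

  precomposeʳ : ScalarAction L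
  precomposeʳ = record
    { _·_    = λ a f u v → f u (a V.*ᵛ v)
    ; ·-cong = λ a eq u v → eq u _
    ; ·-1    = λ f u v → cong (f u) (V.*ₗ-identityˡ v)
    ; ·-⊛    = λ a b f u v → cong (f u)
        (trans (cong (V._*ᵛ v) (L.⊛-comm a b)) (V.*ₗ-assoc b a v))
    ; ·-0ᴹ   = λ a u v → refl
    ; ·-⊕    = λ a b u v → trans (cong (β u) (V.*ₗ-distribʳ v a b)) (additiveʳ u _ _)
    ; ·-definable = graph (mk {U.ty ⊗ V.ty} (uncurry β) (DefinableBiadditive.definable B) ∘ₘ
        ⟪ coord (π₁ ∘ᶜ π₂) , mk {L.ty ⊗ V.ty} (uncurry V._*ᵛ_) V.*-definable ∘ₘ coord ⟨ π₁ , π₂ ∘ᶜ π₂ ⟩ ⟫)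
    }
    where module L = FieldProperties em 𝒰 L

  postcompose : ScalarAction M
  postcompose = record
    { _·_    = λ a f u v → a W.*ᵛ f u v
    ; ·-cong = λ a eq u v → cong (a W.*ᵛ_) (eq u v)
    ; ·-1    = λ f u v → W.*ₗ-identityˡ _
    ; ·-⊛    = λ a b f u v → W.*ₗ-assoc a b _
    ; ·-0ᴹ   = λ a u v → W.*ₗ-zeroʳ a
    ; ·-⊕    = λ a b u v → W.*ₗ-distribʳ _ a b
    ; ·-definable = graph (mk {M.ty ⊗ W.ty} (uncurry W._*ᵛ_) W.*-definable ∘ₘ
        ⟪ coord π₁ , mk {U.ty ⊗ V.ty} (uncurry β) (DefinableBiadditive.definable B) ∘ₘ coord π₂ ⟫)
    }
    where module M = FieldProperties em 𝒰 M

  module _ {A C : DefinableField 𝒰} (α : ScalarAction A) (γ : ScalarAction C) where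
    private
      module A = FieldProperties em 𝒰 A
      module C = FieldProperties em 𝒰 C
      module α = ScalarAction α
      module γ = ScalarAction γ

    Agree : Pred ⟦ A.ty ⊗ C.ty ⟧ ℓ
    Agree (a , c) = a α.· β ≈ c γ.· β

    -- Products agree because a a′ β = a c′ β = c′ a β = c′ c β, which uses that the two actions
    -- commute. Functionality and injectivity come from faithfulness on `β`.
    agree-isCorrespondence : (∀ a c f → a α.· c γ.· f ≈ c γ.· a α.· f) →
      Infinite Agree → IsCorrespondence A C Agree
    agree-isCorrespondence commute infinite = record
      { definable  = extensional ((λ eq u v → eq (u , v)) , λ eq (u , v) → eq u v)
          (universal (equal
            (mk {A.ty ⊗ U.ty ⊗ V.ty} _ α.·-definable ∘ₘ coord ⟨ π₁ ∘ᶜ π₁ , π₂ ⟩)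
            (mk {C.ty ⊗ U.ty ⊗ V.ty} _ γ.·-definable ∘ₘ coord ⟨ π₂ ∘ᶜ π₁ , π₂ ⟩)))
      ; infinite   = infinite
      ; 1-related  = λ u v → trans (α.·-1 β u v) (sym (γ.·-1 β u v))
      ; ⊕-related  = λ {a} {c} {a′} {c′} s s′ u v → trans (α.·-⊕ a a′ u v)
          (trans (cong₂ W._+ᵛ_ (s u v) (s′ u v)) (sym (γ.·-⊕ c c′ u v)))
      ; ⊛-related  = λ {a} {c} {a′} {c′} s s′ u v →
          trans (α.·-⊛ a a′ β u v) (trans (α.·-cong a s′ u v) (trans (commute a c′ β u v)
            (trans (γ.·-cong c′ s u v) (trans (sym (γ.·-⊛ c′ c β u v))
              (cong (λ x → (x γ.· β) u v) (C.⊛-comm c′ c))))))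
      ; ⊖-related  = λ {a} {c} s u v → W.+-cancelˡ ((a α.· β) u v) _ _
          (trans (α.·-⊖ a u v) (trans (sym (γ.·-⊖ c u v))
            (cong (W._+ᵛ ((C.⊖ c) γ.· β) u v) (sym (s u v)))))
      -- The chain is a′ β = a′ c′ c β = c′ a′ c β = c′ a′ a β = c′ β.
      ; inverse-related = λ {a} {c} {a′} {c′} s aa′ cc′ u v →
          trans (α.·-cong a′ (λ u v → sym (γ.·-inverse cc′ β u v)) u v)
            (trans (commute a′ c′ (c γ.· β) u v)
              (γ.·-cong c′ (λ u v → trans (α.·-cong a′ (λ u v → sym (s u v)) u v) (α.·-inverse aa′ β u v)) u v))
      ; functional = λ s s′ → γ.·-injective λ u v → trans (sym (s u v)) (s′ u v)
      ; injective  = λ s s′ → α.·-injective λ u v → trans (s u v) (sym (s′ u v))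
      }

-- Characters, their kernels and the signs ±1.

module CharacterProperties (em : ∀ {a} → ExcludedMiddle a) {ℓ} (𝒰 : Universe ℓ)
                           {T : DefinableGroup 𝒰} {K : DefinableField 𝒰} (κ : Character 𝒰 T K) where
  open Universe 𝒰
  open DefinableGroup T using (_∙_; ε; inv; isGroup; _^_)
  open IsGroup isGroup using (identityˡ; inverseʳ)
  open FieldProperties em 𝒰 K
  open Character κ

  χ-ε : χ ε ≡ 1#
  χ-ε = cancelˡ (nonzero ε) (trans (sym (homo ε ε)) (trans (cong χ (identityˡ ε)) (sym (⊛-identityʳ _))))

  χ-inv : ∀ t → χ t ⊛ χ (inv t) ≡ 1#
  χ-inv t = trans (sym (homo t (inv t))) (trans (cong χ (inverseʳ t)) χ-ε)

  χ-^-reflects : ∀ e {s t} → χ (s ^ e) ≡ χ (t ^ e) → χ s ≡ χ t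
  χ-^-reflects Sign.+ eq = eq
  χ-^-reflects Sign.- {s} {t} eq = cancelˡ (nonzero (inv s))
    (trans (trans (⊛-comm _ _) (χ-inv s)) (sym (trans (cong (_⊛ χ t) eq) (trans (⊛-comm _ _) (χ-inv t)))))

  χ-^-≡1 : ∀ e {t} → χ t ≡ 1# → χ (t ^ e) ≡ 1#
  χ-^-≡1 Sign.+ eq = eq
  χ-^-≡1 Sign.- {t} eq = trans (sym (⊛-identityˡ _)) (trans (cong (_⊛ χ (inv t)) (sym eq)) (χ-inv t))

  ≡1-χ-^ : ∀ e {t} → χ (t ^ e) ≡ 1# → χ t ≡ 1#
  ≡1-χ-^ e eq = trans (χ-^-reflects e (trans eq (sym (χ-^-≡1 e χ-ε)))) χ-ε

  ≡⇒ker : ∀ {s t} → χ s ≡ χ t → ker (inv s ∙ t)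
  ≡⇒ker {s} {t} eq = trans (homo (inv s) t)
    (trans (cong (χ (inv s) ⊛_) (sym eq)) (trans (⊛-comm _ _) (χ-inv s)))

  ker-closed : ∀ {s t} → ker s → ker t → ker (inv s ∙ t)
  ker-closed p q = ≡⇒ker (trans p (sym q))

  infinite-im : Infinite im → InfiniteModulo (λ (t : ⟦ DefinableGroup.ty T ⟧) → ⊤ {ℓ}) (λ s t → χ s ≡ χ t)
  infinite-im inf (ts , cov) = inf (map χ ts , λ { x (t , refl) → map⁺ (cov t tt) })

-- Consequences of covariance for kernels and fields.

module Main (em : ∀ {a} → ExcludedMiddle a) {ℓ} (𝒰 : Universe ℓ) (fmr : FiniteMorleyRank 𝒰)
            (K L M : DefinableField 𝒰)
            (U : DefinableVectorSpace 𝒰 K) (V : DefinableVectorSpace 𝒰 L) (W : DefinableVectorSpace 𝒰 M)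
            (T : DefinableGroup 𝒰)
            (κ : Character 𝒰 T K) (λ′ : Character 𝒰 T L) (μ : Character 𝒰 T M)
            (B : DefinableBiadditive 𝒰 U V W) (B≢0 : DefinableBiadditive.Nonzero B)
            (covariant : DefinableBiadditive.±Covariant B κ λ′ μ) where
  open Classical em
  open Universe 𝒰
  open Correspondences em 𝒰 fmr
  open Scalars em 𝒰 fmr B B≢0
  open DefinableBiadditive B using (β)
  open DefinableGroup T using (_^_)
  private
    module K = FieldProperties em 𝒰 K
    module L = FieldProperties em 𝒰 L
    module M = FieldProperties em 𝒰 M
    module κ where
      open Character κ public
      open CharacterProperties em 𝒰 κ public
    module λ′ where
      open Character λ′ public
      open CharacterProperties em 𝒰 λ′ public
    module μ where
      open Character μ public
      open CharacterProperties em 𝒰 μ public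
    open ScalarAction precomposeˡ using () renaming (_·_ to _·ᴷ_; ·-1 to ·ᴷ-1)
    open ScalarAction precomposeʳ using ()
      renaming (_·_ to _·ᴸ_; ·-1 to ·ᴸ-1; ·-⊛ to ·ᴸ-⊛; ·-inverse to ·ᴸ-inverse;
                ·-injective to ·ᴸ-injective)
    open ScalarAction postcompose using () renaming (_·_ to _·ᴹ_; ·-1 to ·ᴹ-1; ·-injective to ·ᴹ-injective)

    T₀ = ⟦ DefinableGroup.ty T ⟧
    εK = proj₁ covariant
    εL = proj₁ (proj₂ covariant)
    εM = proj₁ (proj₂ (proj₂ covariant))

    -- With the signs absorbed into `k`, `l` and `m`, covariance becomes an identity between scalars
    -- acting on `β`.
    k : T₀ → ⟦ K.ty ⟧
    k t = κ.χ (t ^ εK)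
    l : T₀ → ⟦ L.ty ⟧
    l t = λ′.χ (t ^ εL)
    m : T₀ → ⟦ M.ty ⟧
    m t = μ.χ (t ^ εM)

    l⁻¹ : T₀ → ⟦ L.ty ⟧
    l⁻¹ t = proj₁ (L.invertible (l t) (λ′.nonzero _))

    ll⁻¹ : ∀ t → l t L.⊛ l⁻¹ t ≡ L.1#
    ll⁻¹ t = proj₂ (L.invertible (l t) (λ′.nonzero _))

    covariance : ∀ t → k t ·ᴷ l t ·ᴸ β ≈ m t ·ᴹ β
    covariance = proj₂ (proj₂ (proj₂ covariant))

    kerκ-covariance : ∀ {t} → κ.ker t → l t ·ᴸ β ≈ m t ·ᴹ β
    kerκ-covariance {t} p u v = trans
      (sym (trans (cong (λ a → (a ·ᴷ l t ·ᴸ β) u v) (κ.χ-^-≡1 εK p)) (·ᴷ-1 (l t ·ᴸ β) u v)))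
      (covariance t u v)

    -- Substituting l⁻¹ v for v moves the scalar `l t` to the other side.
    move-l : ∀ {t x} → k t ·ᴷ l t ·ᴸ β ≈ x ·ᴸ β → k t ·ᴷ β ≈ (l⁻¹ t L.⊛ x) ·ᴸ β
    move-l {t} {x} eq u v = trans (sym (·ᴸ-inverse (ll⁻¹ t) β (k t U.*ᵛ u) v))
      (trans (eq u (l⁻¹ t V.*ᵛ v)) (sym (·ᴸ-⊛ (l⁻¹ t) x β u v)))
      where
      module U = DefinableVectorSpace U
      module V = DefinableVectorSpace V

    kerR : Pred T₀ ℓ
    kerR = kerρ 𝒰 κ λ′ μ

    -- On ker κ covariance reads l β = m β, so once l is 1, faithfulness forces m to be 1.
    kerκ∩kerλ⊆kerμ : ∀ {t} → κ.ker t → λ′.ker t → μ.ker t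
    kerκ∩kerλ⊆kerμ {t} p q = μ.≡1-χ-^ εM (·ᴹ-injective λ u v →
      trans (sym (kerκ-covariance p u v))
        (trans (cong (λ a → (a ·ᴸ β) u v) (λ′.χ-^-≡1 εL q)) (trans (·ᴸ-1 β u v) (sym (·ᴹ-1 β u v)))))

    kerκ∩kerμ⊆kerλ : ∀ {t} → κ.ker t → μ.ker t → λ′.ker t
    kerκ∩kerμ⊆kerλ {t} p q = λ′.≡1-χ-^ εL (·ᴸ-injective λ u v →
      trans (kerκ-covariance p u v)
        (trans (cong (λ a → (a ·ᴹ β) u v) (μ.χ-^-≡1 εM q)) (trans (·ᴹ-1 β u v) (sym (·ᴸ-1 β u v)))))

    triple : ∀ {t} → κ.ker t → λ′.ker t → μ.ker t → kerR t
    triple p q r = cong₂ _,_ p (cong₂ _,_ q r)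

  kerρ-κλ : kerR ≐ (κ.ker ∩ λ′.ker)
  kerρ-κλ = (λ eq → cong proj₁ eq , cong (proj₁ ∘ proj₂) eq)
          , (λ (p , q) → triple p q (kerκ∩kerλ⊆kerμ p q))

  kerρ-κμ : kerR ≐ (κ.ker ∩ μ.ker)
  kerρ-κμ = (λ eq → cong proj₁ eq , cong (proj₂ ∘ proj₂) eq)
          , (λ (p , q) → triple p (kerκ∩kerμ⊆kerλ p q) q)

  private
    corrKL : Infinite (Agree precomposeˡ precomposeʳ) → IsCorrespondence K L _
    corrKL = agree-isCorrespondence precomposeˡ precomposeʳ (λ _ _ _ _ _ → refl)

    corrLM : Infinite (Agree precomposeʳ postcompose) → IsCorrespondence L M _
    corrLM = agree-isCorrespondence precomposeʳ postcompose (λ _ _ _ _ _ → refl)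

  -- For t in ker κ the pair (l t , m t) agrees on `β`. By `kerρ-κλ` the value l t determines t
  -- modulo ker ρ there, so infinitely many pairs arise.
  kerκ-infinite : InfiniteQuotient 𝒰 T κ.ker kerR → IsCorrespondence L M (Agree precomposeʳ postcompose)
  kerκ-infinite inf = corrLM (infinite-image inf (λ t → l t , m t) kerκ-covariance
    λ p p′ eq → proj₂ kerρ-κλ (κ.ker-closed p p′ , λ′.≡⇒ker (λ′.χ-^-reflects εL (cong proj₁ eq))))

  -- The correspondence between L and M replaces m t by a scalar x t of L. Then k t acts on `β` as
  -- l⁻¹ x, and k takes infinitely many values.
  kerκ-imκ-infinite : InfiniteQuotient 𝒰 T κ.ker kerR → Infinite κ.im → IsCorrespondence K L (Agree precomposeˡ precomposeʳ)
  kerκ-imκ-infinite inf inf′ = corrKL (infinite-image (κ.infinite-im inf′)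
    (λ t → k t , l⁻¹ t L.⊛ x t)
    (λ {t} _ → move-l λ u v → trans (covariance t u v) (sym (proj₂ (onto corr (m t)) u v)))
    λ _ _ eq → κ.χ-^-reflects εK (cong proj₁ eq))
    where
    corr = kerκ-infinite inf
    x : T₀ → ⟦ L.ty ⟧
    x t = proj₁ (onto corr (m t))

  -- On ker μ covariance reads k l β = β, so k t acts as the inverse of l t. By `kerρ-κμ` the value
  -- k t determines t modulo ker ρ there.
  kerμ-infinite : InfiniteQuotient 𝒰 T μ.ker kerR → IsCorrespondence K L (Agree precomposeˡ precomposeʳ)
  -- The factor `L.1#` gives the second component the shape that `move-l` produces for x = 1.
  kerμ-infinite inf = corrKL (infinite-image inf (λ t → k t , l⁻¹ t L.⊛ L.1#)
    (λ {t} p → move-l λ u v → trans (covariance t u v)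
      (trans (cong (λ a → (a ·ᴹ β) u v) (μ.χ-^-≡1 εM p)) (trans (·ᴹ-1 β u v) (sym (·ᴸ-1 β u v)))))
    λ p p′ eq → proj₂ kerρ-κμ (κ.≡⇒ker (κ.χ-^-reflects εK (cong proj₁ eq)) , μ.ker-closed p p′))

  -- The correspondence between K and L replaces k t by a scalar x t of L. Then l t x t acts as m t,
  -- and m takes infinitely many values.
  kerμ-imμ-infinite : InfiniteQuotient 𝒰 T μ.ker kerR → Infinite μ.im → IsCorrespondence L M (Agree precomposeʳ postcompose)
  kerμ-imμ-infinite inf inf′ = corrLM (infinite-image (μ.infinite-im inf′)
    (λ t → l t L.⊛ x t , m t)
    (λ {t} _ u v → trans (·ᴸ-⊛ (l t) (x t) β u v)
      (trans (sym (proj₂ (total corr (k t)) u (l t V.*ᵛ v))) (covariance t u v)))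
    λ _ _ eq → μ.χ-^-reflects εM (cong proj₂ eq))
    where
    module V = DefinableVectorSpace V
    corr = kerμ-infinite inf
    x : T₀ → ⟦ L.ty ⟧
    x t = proj₁ (total corr (k t))

theorem2p2 :
    (∀ {a} → ExcludedMiddle a) →
    ∀ {ℓ} (𝒰 : Universe ℓ) → FiniteMorleyRank 𝒰 →
    (K L M : DefinableField 𝒰)
    (U : DefinableVectorSpace 𝒰 K) (V : DefinableVectorSpace 𝒰 L) (W : DefinableVectorSpace 𝒰 M)
    (T : DefinableGroup 𝒰)
    (κ : Character 𝒰 T K) (λ′ : Character 𝒰 T L) (μ : Character 𝒰 T M)
    (β : DefinableBiadditive 𝒰 U V W) →
    DefinableBiadditive.Nonzero β →
    DefinableBiadditive.±Covariant β κ λ′ μ →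
    let kerκ = Character.ker κ
        kerλ = Character.ker λ′
        kerμ = Character.ker μ
        kerR = kerρ 𝒰 κ λ′ μ
        imκ = Character.im κ
        imμ = Character.im μ
        _≅_ = _≃_ 𝒰
    in ((kerR ≐ (kerκ ∩ kerλ)) × (kerR ≐ (kerκ ∩ kerμ)))
       × (InfiniteQuotient 𝒰 T kerκ kerR → L ≅ M)
       × (InfiniteQuotient 𝒰 T kerκ kerR → Infinite imκ → (K ≅ L) × (L ≅ M))
       × (InfiniteQuotient 𝒰 T kerμ kerR → K ≅ L)
       × (InfiniteQuotient 𝒰 T kerμ kerR → Infinite imμ → (K ≅ L) × (L ≅ M))
theorem2p2 em 𝒰 fmr K L M U V W T κ λ′ μ B B≢0 covariant =
    (kerρ-κλ , kerρ-κμ)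
  , (λ inf → correspondence⇒≃ (kerκ-infinite inf))
  , (λ inf inf′ → correspondence⇒≃ (kerκ-imκ-infinite inf inf′) , correspondence⇒≃ (kerκ-infinite inf))
  , (λ inf → correspondence⇒≃ (kerμ-infinite inf))
  , (λ inf inf′ → correspondence⇒≃ (kerμ-infinite inf) , correspondence⇒≃ (kerμ-imμ-infinite inf inf′))
  where
  open Correspondences em 𝒰 fmr
  open Main em 𝒰 fmr K L M U V W T κ λ′ μ B B≢0 covariant
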